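{- For every $\epsilon>0$ there is an instance $(T,s)$ of the firefighter problem on trees for which the integrality gap of (LP') (the LP with Hartke's constraints) is at most $\frac56+\epsilon$, i.e. $$\frac{\mathrm{OPT}(T,s)}{\mathrm{LP}'(T,s)}\le\frac56+\epsilon ,$$ where $\mathrm{LP}'(T,s)$ denotes the optimal value of (LP').
   Context: $T=(V,E)$ is a finite tree rooted at the source $s$ where the fire starts. A strategy is a sequence $\{u_t\}_{t\ge1}$ of vertices, $u_t$ being picked at time $t$. A vertex $u$ is saved if on the path $(s=v_0,\dots,v_z=u)$ we have $v_i\in\{u_1,\dots,u_i\}$ for some $i\in\{1,\dots,z\}$. $\mathrm{OPT}(T,s)$ is the maximum number of vertices saved by a strategy. For $j\ge 1$ let $L_j$ be the set of vertices at distance exactly $j$ from $s$, let $P_v$ be the set of vertices on the path from $s$ to $v$, and let $T_v$ be the subtree rooted at $v$. (LP') is: maximize $\sum_{v\in V}y_v$ subject to $\sum_{u\in P_v\cup(T_v\cap L_j)}x_u\le1$ for every vertex $v$ and every layer $L_j$ below the layer of $v$; $y_v\le\sum_{u\in P_v}x_u$ for every $v\in V$; $x_v,y_v\in[0,1]$ for every $v$; and $x_s=0$ (the source cannot be picked). -}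

module Defs where

open import Data.Nat.Base as ℕ using (ℕ; zero; suc)
import Data.Nat.Properties as ℕ
open import Data.Integer.Base using (+_)
open import Data.Rational.Base as ℚ using (ℚ; 0ℚ; 1ℚ)
open import Data.Fin.Base using (Fin; toℕ)
import Data.Fin.Properties as Fin
open import Data.List.Base
  using (List; []; _∷_; [_]; map; concatMap; foldr; filter; length; lookup; allFin)
open import Data.List.Membership.Propositional using (_∈_)
import Data.List.Membership.DecPropositional as DecMembership
open import Data.Product.Base using (∃-syntax; _×_; _,_)
open import Data.Unit.Base using (⊤)
open import Data.Sum.Base using (_⊎_)
open import Level using (0ℓ; _⊔_)
open import Relation.Binary.Core using (Rel)
open import Relation.Binary.Definitions using (DecidableEquality)
open import Relation.Binary.PropositionalEquality.Core using (_≡_; refl)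
open import Relation.Nullary using (yes; no)
open import Relation.Nullary.Decidable using (_×-dec_; _⊎-dec_)
open import Relation.Unary using (Pred; Decidable)

-- Finite rooted trees: a root together with the subtrees hanging from its
-- children. The fire starts at the root.
data Tree : Set where
  node : (k : ℕ) → (Fin k → Tree) → Tree

data Vertex : Tree → Set where
  root  : ∀ {k ts} → Vertex (node k ts)
  child : ∀ {k ts} (i : Fin k) → Vertex (ts i) → Vertex (node k ts)

source : (t : Tree) → Vertex t
source (node _ _) = root

_≟ᵛ_ : ∀ {t} → DecidableEquality (Vertex t)
root      ≟ᵛ root      = yes refl
root      ≟ᵛ child _ _ = no λ ()
child _ _ ≟ᵛ root      = no λ ()
child i u ≟ᵛ child j v with i Fin.≟ j
... | no i≢j = no λ { refl → i≢j refl }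
... | yes refl with u ≟ᵛ v
...   | yes refl = yes refl
...   | no u≢v   = no λ { refl → u≢v refl }

open module VertexMembership {t} = DecMembership (_≟ᵛ_ {t}) using (_∈?_)

-- Every vertex, listed exactly once.
vertices : (t : Tree) → List (Vertex t)
vertices (node k ts) = root ∷ concatMap (λ i → map (child i) (vertices (ts i))) (allFin k)

-- Distance from the source.
depth : ∀ {t} → Vertex t → ℕ
depth root        = zero
depth (child _ v) = suc (depth v)

-- path v is (s = v₀ , … , v_z = v), both ends included; the entry at position i is vᵢ.
-- Its members form P_v.
path : ∀ {t} → Vertex t → List (Vertex t)
path root        = [ root ]
path (child i v) = root ∷ map (child i) (path v)

-- T_v as a set of vertices: w is in it when v lies on the path from the source to w.
Subtree : ∀ {t} → Vertex t → Pred (Vertex t) 0ℓ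
Subtree v w = v ∈ path w

Layer : ∀ {t} → ℕ → Pred (Vertex t) 0ℓ
Layer j w = depth w ≡ j

IsMaximum : ∀ {a b ℓ p} {A : Set a} {B : Set b} →
            Rel B ℓ → Pred A p → (A → B) → B → Set (a ⊔ b ⊔ ℓ ⊔ p)
IsMaximum _≤_ P f m = (∃[ a ] P a × f a ≡ m) × (∀ a → P a → f a ≤ m)

-- The sequence u₁, u₂, … is indexed from 0: σ k is u_{k+1}, the pick at time k + 1.
Strategy : Tree → Set
Strategy t = ℕ → Vertex t

-- vᵢ ∈ {u₁ , … , uᵢ} is: σ k ≡ vᵢ for some k < i. For i = 0 there is no such k,
-- so i effectively ranges over 1 , … , z.
Saved : ∀ {t} → Strategy t → Pred (Vertex t) 0ℓ
Saved σ u = ∃[ i ] ∃[ k ] σ (toℕ {toℕ i} k) ≡ lookup (path u) i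

saved? : ∀ {t} (σ : Strategy t) → Decidable (Saved σ)
saved? σ u = Fin.any? λ i → Fin.any? λ k → σ (toℕ k) ≟ᵛ lookup (path u) i

savedCount : ∀ {t} → Strategy t → ℕ
savedCount {t} σ = length (filter (saved? σ) (vertices t))

IsOPT : Tree → ℕ → Set
IsOPT t = IsMaximum ℕ._≤_ (λ (_ : Strategy t) → ⊤) savedCount

∑ : ∀ {a} {A : Set a} → List A → (A → ℚ) → ℚ
∑ us f = foldr (λ u acc → f u ℚ.+ acc) 0ℚ us

HartkeSet : ∀ {t} → Vertex t → ℕ → Pred (Vertex t) 0ℓ
HartkeSet v j u = u ∈ path v ⊎ (Subtree v u × Layer j u)

hartkeSet? : ∀ {t} (v : Vertex t) (j : ℕ) → Decidable (HartkeSet v j)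
hartkeSet? v j u = (u ∈? path v) ⊎-dec ((v ∈? path u) ×-dec (depth u ℕ.≟ j))

record LP′-Feasible (t : Tree) (x y : Vertex t → ℚ) : Set where
  field
    hartke : ∀ v j → depth v ℕ.< j → ∑ (filter (hartkeSet? v j) (vertices t)) x ℚ.≤ 1ℚ
    y≤∑x   : ∀ v → y v ℚ.≤ ∑ (path v) x
    0≤x    : ∀ v → 0ℚ ℚ.≤ x v
    x≤1    : ∀ v → x v ℚ.≤ 1ℚ
    0≤y    : ∀ v → 0ℚ ℚ.≤ y v
    y≤1    : ∀ v → y v ℚ.≤ 1ℚ
    x-source : x (source t) ≡ 0ℚ

IsLP′ : Tree → ℚ → Set
IsLP′ t = IsMaximum {A = (Vertex t → ℚ) × (Vertex t → ℚ)} ℚ._≤_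
  (λ (x , y) → LP′-Feasible t x y) (λ (x , y) → ∑ (vertices t) y)

fromℕ : ℕ → ℚ
fromℕ n = + n ℚ./ 1

{-# OPTIONS --safe #-}

-- Each layer of the instance carries two fractional picks of 1/2, listed here phase by phase;
-- a phase is a block of consecutive layers, and all six weights a₁, a₂, b₁, b₂, c, d are equal.
--   layer 1                 : the roots of A and B
--   layer 2                 : a₁ (below A) and the branching vertex of C
--   layers 3 … 2+2p         : b₁ and b₂ (2p legs of B), and the p branches D, each of them twice
--   layers 3+2p … 2+2p+q    : a₂ (q legs of A) and c (q legs of C)
-- Every weight is crossed by two half-picks, so the LP saves all six. An integral strategy loses
-- about one of them, because p = R and q = R² make each phase much longer than everything before it:
-- without the root of B, the 3p legs of B and D share about 2p picks; with it, but without the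
-- branching vertex of C, the 2q legs of A and C share about q picks; with both, a₁ is lost.
-- The weights are stars with so many leaves that all other vertices are negligible. That both optima
-- exist is shown by enumerating strategies and by Fourier–Motzkin elimination over ℚ.

module Submission where

-- A pick made at time `t` can save something only if its depth is at least `t`. So the roots of
-- `A`, `B` and `C` count only as the first pick and `topC` only as one of the first two, and these
-- two picks decide the case. Each case is then one union bound, `savedCount-bound`: a 0/1 function
-- `g` marks a contested region and vanishes below depth `H`; if every pick that counts covers at
-- most `M` of it, then at least `total g - H * M` vertices burn. Origin of the sizes: `q = R²` legs
-- of length up to about `R²` use about `R⁴` chain vertices, and a bounded number of surplus picks
-- on stars of `R⁴` leaves costs as much. Hence each of the six weights is `R⁵`, divided among 1,
-- `p` or `q` stars. This gives at least `6 R⁵` for the LP and at most `5 R⁵ + 78 R⁴` for a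
-- strategy. For the LP a lower bound is enough, but its optimal value has to be exhibited as a
-- rational number that is attained. Compactness yields no maximum over ℚ; elimination does, since
-- it only adds, multiplies and divides coefficients.

open import Defs
open VertexMembership using (_∈?_)
open import Data.Bool.Base using (if_then_else_)
open import Data.Fin.Base as Fin using (Fin; zero; suc; toℕ; fromℕ<)
import Data.Fin.Properties as Fin
open import Data.Integer.Base as ℤ using (+[1+_]; -[1+_])
import Data.Integer.Properties as ℤ
open import Data.List.Base as List
  using (List; []; _∷_; _++_; cartesianProductWith; cartesianProduct; length; map; filter; foldr; upTo; allFin; concatMap)
import Data.List.Properties as List
open import Data.List.Extrema.Nat using (argmax; f[xs]≤f[argmax]) renaming (max to maxℕ; xs≤max to xs≤maxℕ)
open import Data.List.Membership.Propositional using (_∈_; lose)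
open import Data.List.Membership.Propositional.Properties
open import Data.List.Relation.Unary.All as All using (All; []; _∷_)
import Data.List.Relation.Unary.All.Properties as All
open import Data.List.Relation.Unary.Any using (here; there; index)
open import Data.List.Relation.Unary.Any.Properties using (lookup-index)
open import Data.Nat.Base as ℕ using (ℕ; zero; suc; s≤s; z≤n; _≡ᵇ_)
import Data.Nat.Properties as ℕ
open import Data.Nat.ListAction using () renaming (sum to sumᴸ)
open import Data.Nat.ListAction.Properties using () renaming (sum-++ to sumᴸ-++)
open import Data.Nat.Solver using () renaming (module +-*-Solver to ℕ-Solver)
open import Data.Product using (Σ-syntax; ∃-syntax; _×_; _,_; proj₁; proj₂; map₁)
open import Data.Rational.Base as ℚ using (ℚ; 0ℚ; 1ℚ; ½; mkℚ; toℚᵘ; Positive; _÷_)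
import Data.Rational.Properties as ℚ
open import Data.Rational.Solver using () renaming (module +-*-Solver to ℚ-Solver)
open import Data.Rational.Unnormalised.Base as ℚᵘ using (mkℚᵘ; *≡*; *≤*)
import Data.Rational.Unnormalised.Properties as ℚᵘ
open import Data.Sum.Base using (_⊎_; inj₁; inj₂; [_,_])
open import Data.Unit.Base using (tt)
open import Data.Vec.Base as Vec using (Vec; []; _∷_; zipWith; replicate; lookup)
import Data.Vec.Properties as Vec
open import Function.Base using (_∘_; id)
open import Function.Bundles using (_⇔_; mk⇔; module Equivalence)
open import Level using (0ℓ)
open import Relation.Binary.Bundles using (module DecTotalOrder)
open import Relation.Binary.Definitions using (tri<; tri≈; tri>)
open import Relation.Binary.PropositionalEquality
  using (_≡_; _≢_; refl; sym; trans; cong; cong₂; subst; subst₂; module ≡-Reasoning)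
open import Relation.Nullary using (Dec; yes; no; does; ¬_; contradiction)
open import Relation.Unary using (Pred; Decidable)

open import Algebra.Properties.CommutativeMonoid.Sum ℕ.+-0-commutativeMonoid
  using (sum; ∑-distrib-+; sum-cong-≗)
open import Algebra.Properties.Semiring.Sum ℕ.+-*-semiring using (*-distribˡ-sum)
open import Data.List.Extrema (DecTotalOrder.totalOrder ℚ.≤-decTotalOrder)
  using (max; min; max≤v⁺; xs≤max; v≤min⁺; min≤xs)
open Equivalence using (to; from)

-- Fourier–Motzkin elimination

0≤q-p⇔p≤q : ∀ p q → 0ℚ ℚ.≤ q ℚ.- p ⇔ p ℚ.≤ q
0≤q-p⇔p≤q p q = mk⇔
  (λ h → begin
    p               ≡⟨ ℚ.+-identityˡ p ⟨
    0ℚ ℚ.+ p        ≤⟨ ℚ.+-monoˡ-≤ p h ⟩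
    q ℚ.- p ℚ.+ p   ≡⟨ solve 2 (λ p q → q :- p :+ p := q) refl p q ⟩
    q               ∎)
  (λ h → begin
    0ℚ       ≡⟨ ℚ.+-inverseʳ p ⟨
    p ℚ.- p  ≤⟨ ℚ.+-monoˡ-≤ (ℚ.- p) h ⟩
    q ℚ.- p  ∎)
  where
    open ℚ.≤-Reasoning
    open ℚ-Solver using (solve; _:=_; _:+_; _:*_; _:-_; :-_; con)

Aff : ℕ → Set
Aff n = Vec ℚ n × ℚ

⟦_⟧ : ∀ {n} → Aff n → Vec ℚ n → ℚ
⟦ []     , b ⟧ []      = b
⟦ a ∷ as , b ⟧ (q ∷ ρ) = a ℚ.* q ℚ.+ ⟦ as , b ⟧ ρ

Sat : ∀ {n} → Vec ℚ n → Aff n → Set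
Sat ρ f = 0ℚ ℚ.≤ ⟦ f ⟧ ρ

_⊞_ : ∀ {n} → Aff n → Aff n → Aff n
(as , b) ⊞ (cs , d) = zipWith ℚ._+_ as cs , b ℚ.+ d

_⊡_ : ∀ {n} → ℚ → Aff n → Aff n
k ⊡ (as , b) = Vec.map (k ℚ.*_) as , k ℚ.* b

_⊟_ : ∀ {n} → Aff n → Aff n → Aff n
f ⊟ g = f ⊞ ((ℚ.- 1ℚ) ⊡ g)

constant : ∀ {n} → ℚ → Aff n
constant b = replicate _ 0ℚ , b

variable-at : ∀ {n} → Fin n → Aff n
variable-at zero    = 1ℚ ∷ replicate _ 0ℚ , 0ℚ
variable-at (suc i) = map₁ (0ℚ ∷_) (variable-at i)

⟦⟧-⊞ : ∀ {n} (f g : Aff n) ρ → ⟦ f ⊞ g ⟧ ρ ≡ ⟦ f ⟧ ρ ℚ.+ ⟦ g ⟧ ρ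
⟦⟧-⊞ ([]     , b) ([]     , d) []      = refl
⟦⟧-⊞ (a ∷ as , b) (c ∷ cs , d) (q ∷ ρ) = trans
  (cong ((a ℚ.+ c) ℚ.* q ℚ.+_) (⟦⟧-⊞ (as , b) (cs , d) ρ))
  (solve 5 (λ a c q u v → (a :+ c) :* q :+ (u :+ v) := (a :* q :+ u) :+ (c :* q :+ v))
    refl a c q _ _)
  where open ℚ-Solver using (solve; _:=_; _:+_; _:*_; _:-_; :-_; con)

⟦⟧-⊡ : ∀ {n} k (f : Aff n) ρ → ⟦ k ⊡ f ⟧ ρ ≡ k ℚ.* ⟦ f ⟧ ρ
⟦⟧-⊡ k ([]     , b) []      = refl
⟦⟧-⊡ k (a ∷ as , b) (q ∷ ρ) = trans
  (cong ((k ℚ.* a) ℚ.* q ℚ.+_) (⟦⟧-⊡ k (as , b) ρ))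
  (solve 4 (λ k a q u → k :* a :* q :+ k :* u := k :* (a :* q :+ u)) refl k a q _)
  where open ℚ-Solver using (solve; _:=_; _:+_; _:*_; _:-_; :-_; con)

⟦⟧-⊟ : ∀ {n} (f g : Aff n) ρ → ⟦ f ⊟ g ⟧ ρ ≡ ⟦ f ⟧ ρ ℚ.- ⟦ g ⟧ ρ
⟦⟧-⊟ f g ρ = begin
  ⟦ f ⊟ g ⟧ ρ                           ≡⟨ ⟦⟧-⊞ f _ ρ ⟩
  ⟦ f ⟧ ρ ℚ.+ ⟦ (ℚ.- 1ℚ) ⊡ g ⟧ ρ         ≡⟨ cong (⟦ f ⟧ ρ ℚ.+_) (⟦⟧-⊡ (ℚ.- 1ℚ) g ρ) ⟩
  ⟦ f ⟧ ρ ℚ.+ (ℚ.- 1ℚ) ℚ.* ⟦ g ⟧ ρ       ≡⟨ solve 2 (λ u v → u :+ (:- con 1ℚ) :* v := u :- v) refl (⟦ f ⟧ ρ) _ ⟩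
  ⟦ f ⟧ ρ ℚ.- ⟦ g ⟧ ρ                    ∎
  where
    open ≡-Reasoning
    open ℚ-Solver using (solve; _:=_; _:+_; _:*_; _:-_; :-_; con)

⟦⟧-constant : ∀ {n} b (ρ : Vec ℚ n) → ⟦ constant b ⟧ ρ ≡ b
⟦⟧-constant b []      = refl
⟦⟧-constant b (q ∷ ρ) = trans (cong₂ ℚ._+_ (ℚ.*-zeroˡ q) (⟦⟧-constant b ρ)) (ℚ.+-identityˡ b)

⟦⟧-variable : ∀ {n} i (ρ : Vec ℚ n) → ⟦ variable-at i ⟧ ρ ≡ lookup ρ i
⟦⟧-variable zero    (q ∷ ρ) =
  trans (cong₂ ℚ._+_ (ℚ.*-identityˡ q) (⟦⟧-constant 0ℚ ρ)) (ℚ.+-identityʳ q)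
⟦⟧-variable (suc i) (q ∷ ρ) =
  trans (cong₂ ℚ._+_ (ℚ.*-zeroˡ q) (⟦⟧-variable i ρ)) (ℚ.+-identityˡ _)

Sat-⊟ : ∀ {n} (f g : Aff n) ρ → Sat ρ (f ⊟ g) ⇔ ⟦ g ⟧ ρ ℚ.≤ ⟦ f ⟧ ρ
Sat-⊟ f g ρ = subst (λ v → 0ℚ ℚ.≤ v ⇔ ⟦ g ⟧ ρ ℚ.≤ ⟦ f ⟧ ρ) (sym (⟦⟧-⊟ f g ρ)) (0≤q-p⇔p≤q _ _)

-- The sign of the first coefficient decides the constructor. Each one carries an equivalence, so
-- that later steps need not look at coefficients again.
data Bound {n} (f : Aff (suc n)) : Set where
  upper : (u : Aff n) → (∀ q ρ → Sat (q ∷ ρ) f ⇔ q ℚ.≤ ⟦ u ⟧ ρ) → Bound f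
  lower : (l : Aff n) → (∀ q ρ → Sat (q ∷ ρ) f ⇔ ⟦ l ⟧ ρ ℚ.≤ q) → Bound f
  none  : (g : Aff n) → (∀ q ρ → Sat (q ∷ ρ) f ⇔ Sat ρ g)       → Bound f

-- The zero of `a * q + f` in `q`, as an affine form in the other variables.
solveFor : ∀ {n} a .{{_ : ℚ.NonZero a}} (f : Aff n) → Aff n
solveFor a f = (ℚ.- (ℚ.1/ a)) ⊡ f

-- Both sides keep the factor `a`, so that one equivalence serves either sign. It is cancelled in
-- `bound`, where a negative `a` reverses the inequality.
Sat-solveFor : ∀ {n} a .{{_ : ℚ.NonZero a}} (f : Aff n) q ρ →
               0ℚ ℚ.≤ a ℚ.* q ℚ.+ ⟦ f ⟧ ρ ⇔ a ℚ.* ⟦ solveFor a f ⟧ ρ ℚ.≤ a ℚ.* q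
Sat-solveFor a f q ρ =
  subst (λ v → 0ℚ ℚ.≤ v ⇔ a ℚ.* ⟦ solveFor a f ⟧ ρ ℚ.≤ a ℚ.* q) eq (0≤q-p⇔p≤q _ _)
  where
    open ≡-Reasoning
    open ℚ-Solver using (solve; _:=_; _:+_; _:*_; _:-_; :-_; con)
    r = ⟦ f ⟧ ρ
    eq : a ℚ.* q ℚ.- a ℚ.* ⟦ solveFor a f ⟧ ρ ≡ a ℚ.* q ℚ.+ r
    eq = begin
      a ℚ.* q ℚ.- a ℚ.* ⟦ solveFor a f ⟧ ρ
        ≡⟨ cong (λ v → a ℚ.* q ℚ.- a ℚ.* v) (⟦⟧-⊡ (ℚ.- (ℚ.1/ a)) f ρ) ⟩
      a ℚ.* q ℚ.- a ℚ.* ((ℚ.- (ℚ.1/ a)) ℚ.* r)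
        ≡⟨ solve 4 (λ a q i r → a :* q :- a :* ((:- i) :* r) := a :* q :+ (a :* i) :* r) refl a q (ℚ.1/ a) r ⟩
      a ℚ.* q ℚ.+ (a ℚ.* ℚ.1/ a) ℚ.* r             ≡⟨ cong (λ v → a ℚ.* q ℚ.+ v ℚ.* r) (ℚ.*-inverseʳ a) ⟩
      a ℚ.* q ℚ.+ 1ℚ ℚ.* r                         ≡⟨ cong (a ℚ.* q ℚ.+_) (ℚ.*-identityˡ r) ⟩
      a ℚ.* q ℚ.+ r                                ∎

bound : ∀ {n} (f : Aff (suc n)) → Bound f
bound (a ∷ as , b) with ℚ.<-cmp a 0ℚ
... | tri≈ _ refl _ = none (as , b) λ q ρ →
  subst (λ v → 0ℚ ℚ.≤ v ⇔ Sat ρ (as , b))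
    (sym (trans (cong (ℚ._+ _) (ℚ.*-zeroˡ q)) (ℚ.+-identityˡ _)))
    (mk⇔ id id)
... | tri< a<0 a≢0 _ = upper (solveFor a (as , b)) λ q ρ → mk⇔
    (ℚ.*-cancelˡ-≤-neg a ∘ to (Sat-solveFor a (as , b) q ρ))
    (from (Sat-solveFor a (as , b) q ρ) ∘ ℚ.*-monoˡ-≤-nonPos a {{ℚ.neg⇒nonPos a}})
  where
    instance _ = ℚ.≢-nonZero a≢0
    instance _ = ℚ.negative a<0
... | tri> _ a≢0 a>0 = lower (solveFor a (as , b)) λ q ρ → mk⇔
    (ℚ.*-cancelˡ-≤-pos a ∘ to (Sat-solveFor a (as , b) q ρ))
    (from (Sat-solveFor a (as , b) q ρ) ∘ ℚ.*-monoˡ-≤-nonNeg a {{ℚ.pos⇒nonNeg a}})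
  where
    instance _ = ℚ.≢-nonZero a≢0
    instance _ = ℚ.positive a>0

record Bounds {n} (fs : List (Aff (suc n))) : Set where
  field
    uppers lowers rest : List (Aff n)
    sat⁻ : ∀ {q ρ} → All (Sat (q ∷ ρ)) fs →
           All (λ u → q ℚ.≤ ⟦ u ⟧ ρ) uppers × All (λ l → ⟦ l ⟧ ρ ℚ.≤ q) lowers × All (Sat ρ) rest
    sat⁺ : ∀ {q ρ} → All (λ u → q ℚ.≤ ⟦ u ⟧ ρ) uppers → All (λ l → ⟦ l ⟧ ρ ℚ.≤ q) lowers →
           All (Sat ρ) rest → All (Sat (q ∷ ρ)) fs

bounds : ∀ {n} (fs : List (Aff (suc n))) → Bounds fs
bounds [] = record
  { uppers = [] ; lowers = [] ; rest = [] ; sat⁻ = λ _ → [] , [] , [] ; sat⁺ = λ _ _ _ → [] }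
bounds (f ∷ fs) with bound f
... | upper u eqv = record
  { uppers = u ∷ uppers ; lowers = lowers ; rest = rest
  ; sat⁻ = λ { (p ∷ ps) → let us , ls , gs = sat⁻ ps in to (eqv _ _) p ∷ us , ls , gs }
  ; sat⁺ = λ { (p ∷ us) ls gs → from (eqv _ _) p ∷ sat⁺ us ls gs }
  } where open Bounds (bounds fs)
... | lower l eqv = record
  { uppers = uppers ; lowers = l ∷ lowers ; rest = rest
  ; sat⁻ = λ { (p ∷ ps) → let us , ls , gs = sat⁻ ps in us , to (eqv _ _) p ∷ ls , gs }
  ; sat⁺ = λ { us (p ∷ ls) gs → from (eqv _ _) p ∷ sat⁺ us ls gs }
  } where open Bounds (bounds fs)
... | none g eqv = record
  { uppers = uppers ; lowers = lowers ; rest = g ∷ rest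
  ; sat⁻ = λ { (p ∷ ps) → let us , ls , gs = sat⁻ ps in us , ls , to (eqv _ _) p ∷ gs }
  ; sat⁺ = λ { us ls (p ∷ gs) → from (eqv _ _) p ∷ sat⁺ us ls gs }
  } where open Bounds (bounds fs)

between : ∀ (ls us : List ℚ) → (∀ {l u} → l ∈ ls → u ∈ us → l ℚ.≤ u) →
          ∃[ q ] All (ℚ._≤ q) ls × All (q ℚ.≤_) us
between ls us ls≤us =
  -- The largest lower bound. The default `min 0ℚ us` lies below every upper bound, so an empty `ls`
  -- needs no separate case; `0ℚ` is an arbitrary start.
  max (min 0ℚ us) ls , xs≤max _ ls ,
  All.tabulate λ u∈us → max≤v⁺ (All.lookup (min≤xs 0ℚ us) u∈us) (All.tabulate λ l∈ls → ls≤us l∈ls u∈us)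

eliminate : ∀ {n} → List (Aff (suc n)) → List (Aff n)
eliminate fs = rest ++ cartesianProductWith _⊟_ uppers lowers
  where open Bounds (bounds fs)

eliminate-sound : ∀ {n} (fs : List (Aff (suc n))) {q ρ} →
                  All (Sat (q ∷ ρ)) fs → All (Sat ρ) (eliminate fs)
eliminate-sound fs {q} {ρ} ps with us , ls , gs ← Bounds.sat⁻ (bounds fs) ps =
  All.++⁺ gs (All.tabulate λ f∈ →
    let u , l , u∈ , l∈ , f≡ = ∈-cartesianProductWith⁻ _⊟_ uppers lowers f∈
    in subst (Sat ρ) (sym f≡)
         (from (Sat-⊟ u l ρ) (ℚ.≤-trans (All.lookup ls l∈) (All.lookup us u∈))))
  where open Bounds (bounds fs)

eliminate-complete : ∀ {n} (fs : List (Aff (suc n))) {ρ} →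
                     All (Sat ρ) (eliminate fs) → ∃[ q ] All (Sat (q ∷ ρ)) fs
eliminate-complete fs {ρ} ps =
  let q , ls≤q , q≤us = between (List.map (λ l → ⟦ l ⟧ ρ) lowers) (List.map (λ u → ⟦ u ⟧ ρ) uppers) ls≤us
  in q , sat⁺ (All.map⁻ q≤us) (All.map⁻ ls≤q) (All.++⁻ˡ rest ps)
  where
    open Bounds (bounds fs)
    ls≤us : ∀ {l u} → l ∈ List.map (λ l → ⟦ l ⟧ ρ) lowers → u ∈ List.map (λ u → ⟦ u ⟧ ρ) uppers → l ℚ.≤ u
    ls≤us l∈ u∈ with ∈-map⁻ _ l∈ | ∈-map⁻ _ u∈
    ... | l , l∈' , refl | u , u∈' , refl =
      to (Sat-⊟ u l ρ) (All.lookup (All.++⁻ʳ rest ps) (∈-cartesianProductWith⁺ _⊟_ u∈' l∈'))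

project : ∀ n (fs : List (Aff (n ℕ.+ 1))) → List (Aff 1)
project zero    fs = fs
project (suc n) fs = project n (eliminate fs)

project-sound : ∀ n fs (ρ : Vec ℚ n) {m} →
                All (Sat (ρ Vec.++ m ∷ [])) fs → All (Sat (m ∷ [])) (project n fs)
project-sound zero    fs []      ps = ps
project-sound (suc n) fs (q ∷ ρ) ps = project-sound n (eliminate fs) ρ (eliminate-sound fs ps)

project-complete : ∀ n fs {m} → All (Sat (m ∷ [])) (project n fs) →
                   ∃[ ρ ] All (Sat (ρ Vec.++ m ∷ [])) fs
project-complete zero    fs ps = [] , ps
project-complete (suc n) fs ps =
  let ρ , ps′ = project-complete n (eliminate fs) ps
      q , ps″ = eliminate-complete fs ps′
  in q ∷ ρ , ps″

-- In one variable the feasible set is an interval, and the least of its upper bounds is feasible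
-- because it is at least `q₀`. Putting `B` into the minimum covers the case without upper bounds
-- and excludes no feasible value.
maximum₁ : ∀ (fs : List (Aff 1)) {q₀ B} → All (Sat (q₀ ∷ [])) fs →
           (∀ {q} → All (Sat (q ∷ [])) fs → q ℚ.≤ B) →
           ∃[ q* ] All (Sat (q* ∷ [])) fs × (∀ {q} → All (Sat (q ∷ [])) fs → q ℚ.≤ q*)
maximum₁ fs {q₀} {B} p₀ ≤B = q* , sat⁺ q*≤us (All.map (λ l≤q₀ → ℚ.≤-trans l≤q₀ (≤q* p₀)) ls) gs , ≤q*
  where
    open Bounds (bounds fs)
    us′ = List.map (λ u → ⟦ u ⟧ []) uppers
    q* = min B us′
    ≤q* : ∀ {q} → All (Sat (q ∷ [])) fs → q ℚ.≤ q*
    ≤q* ps = v≤min⁺ (≤B ps) (All.map⁺ (proj₁ (sat⁻ ps)))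
    q*≤us = All.map⁻ (min≤xs B us′)
    ls = proj₁ (proj₂ (sat⁻ p₀))
    gs = proj₂ (proj₂ (sat⁻ p₀))

-- Linear programs over named variables

data Expr (A : Set) : Set where
  const : ℚ → Expr A
  var   : A → Expr A
  _⊕_   : Expr A → Expr A → Expr A
  neg   : Expr A → Expr A

eval : ∀ {A} → (A → ℚ) → Expr A → ℚ
eval z (const b) = b
eval z (var a) = z a
eval z (d ⊕ e) = eval z d ℚ.+ eval z e
eval z (neg e) = ℚ.- eval z e

eval-cong : ∀ {A} {z z′ : A → ℚ} → (∀ a → z a ≡ z′ a) → ∀ e → eval z e ≡ eval z′ e
eval-cong z≗z′ (const b) = refl
eval-cong z≗z′ (var a) = z≗z′ a
eval-cong z≗z′ (d ⊕ e) = cong₂ ℚ._+_ (eval-cong z≗z′ d) (eval-cong z≗z′ e)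
eval-cong z≗z′ (neg e) = cong ℚ.-_ (eval-cong z≗z′ e)

compile : ∀ {A n} → (A → Fin n) → Expr A → Aff n
compile ix (const b) = constant b
compile ix (var a) = variable-at (ix a)
compile ix (d ⊕ e) = compile ix d ⊞ compile ix e
compile ix (neg e) = (ℚ.- 1ℚ) ⊡ compile ix e

⟦⟧-compile : ∀ {A n} (ix : A → Fin n) e ρ → ⟦ compile ix e ⟧ ρ ≡ eval (lookup ρ ∘ ix) e
⟦⟧-compile ix (const b) ρ = ⟦⟧-constant b ρ
⟦⟧-compile ix (var a) ρ = ⟦⟧-variable (ix a) ρ
⟦⟧-compile ix (d ⊕ e) ρ = trans (⟦⟧-⊞ (compile ix d) _ ρ) (cong₂ ℚ._+_ (⟦⟧-compile ix d ρ) (⟦⟧-compile ix e ρ))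
⟦⟧-compile ix (neg e) ρ = begin
  ⟦ (ℚ.- 1ℚ) ⊡ compile ix e ⟧ ρ    ≡⟨ ⟦⟧-⊡ (ℚ.- 1ℚ) (compile ix e) ρ ⟩
  (ℚ.- 1ℚ) ℚ.* ⟦ compile ix e ⟧ ρ  ≡⟨ solve 1 (λ v → (:- con 1ℚ) :* v := :- v) refl _ ⟩
  ℚ.- ⟦ compile ix e ⟧ ρ           ≡⟨ cong ℚ.-_ (⟦⟧-compile ix e ρ) ⟩
  ℚ.- eval (lookup ρ ∘ ix) e       ∎
  where
    open ≡-Reasoning
    open ℚ-Solver using (solve; _:=_; _:+_; _:*_; _:-_; :-_; con)

Feasible : ∀ {A} → List (Expr A) → (A → ℚ) → Set
Feasible cs z = All (λ c → 0ℚ ℚ.≤ eval z c) cs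

-- The objective value is an extra, last coordinate m with m ≤ obj; all the others are eliminated.
linearProgram-maximum :
  ∀ {A} (as : List A) → (∀ a → a ∈ as) → (cs : List (Expr A)) (obj : Expr A) →
  ∀ {z₀ B} → Feasible cs z₀ → (∀ {z} → Feasible cs z → eval z obj ℚ.≤ B) →
  ∃[ z* ] Feasible cs z* × (∀ {z} → Feasible cs z → eval z obj ℚ.≤ eval z* obj)
linearProgram-maximum {A} as ∈as cs obj {z₀} {B} p₀ ≤B =
  let q* , p* , q≤q* = maximum₁ (project n system) (feasible⇒ p₀)
                         (λ p → let _ , pz , q≤ = feasible⇐ p in ℚ.≤-trans q≤ (≤B pz))
      z* , pz* , q*≤ = feasible⇐ p*
  in z* , pz* , λ pz → ℚ.≤-trans (q≤q* (feasible⇒ pz)) q*≤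
  where
    n = length as

    ix : A → Fin (n ℕ.+ 1)
    ix a = index (∈as a) Fin.↑ˡ 1

    m-aff : Aff (n ℕ.+ 1)
    m-aff = variable-at (n Fin.↑ʳ zero)

    system : List (Aff (n ℕ.+ 1))
    system = (compile ix obj ⊟ m-aff) ∷ List.map (compile ix) cs

    ⟦m⟧ : ∀ (ρ : Vec ℚ n) m → ⟦ m-aff ⟧ (ρ Vec.++ m ∷ []) ≡ m
    ⟦m⟧ ρ m = trans (⟦⟧-variable (n Fin.↑ʳ zero) (ρ Vec.++ m ∷ [])) (Vec.lookup-++ʳ ρ (m ∷ []) zero)

    feasible⇒ : ∀ {z} → Feasible cs z → All (Sat (eval z obj ∷ [])) (project n system)
    feasible⇒ {z} pz = project-sound n system ρ
      (from (Sat-⊟ (compile ix obj) m-aff ρm) (ℚ.≤-reflexive (trans (⟦m⟧ ρ _) (sym (same obj))))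
        ∷ All.map⁺ (All.map (λ {c} → subst (0ℚ ℚ.≤_) (sym (same c))) pz))
      where
        ρ = Vec.map z (Vec.fromList as)
        ρm = ρ Vec.++ eval z obj ∷ []
        lookup-ρ : ∀ a → lookup ρm (ix a) ≡ z a
        lookup-ρ a = begin
          lookup ρm (ix a)                              ≡⟨ Vec.lookup-++ˡ ρ _ (index (∈as a)) ⟩
          lookup ρ (index (∈as a))                      ≡⟨ Vec.lookup-map (index (∈as a)) z (Vec.fromList as) ⟩
          z (lookup (Vec.fromList as) (index (∈as a)))  ≡⟨ cong z (lookup-fromList as (index (∈as a))) ⟩
          z (List.lookup as (index (∈as a)))            ≡⟨ cong z (lookup-index (∈as a)) ⟨
          z a                                           ∎
          where
            open ≡-Reasoning
            lookup-fromList : ∀ (xs : List A) i → lookup (Vec.fromList xs) i ≡ List.lookup xs i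
            lookup-fromList (x ∷ xs) zero    = refl
            lookup-fromList (x ∷ xs) (suc i) = lookup-fromList xs i
        same : ∀ e → ⟦ compile ix e ⟧ ρm ≡ eval z e
        same e = trans (⟦⟧-compile ix e ρm) (eval-cong lookup-ρ e)

    feasible⇐ : ∀ {q} → All (Sat (q ∷ [])) (project n system) → ∃[ z ] Feasible cs z × q ℚ.≤ eval z obj
    feasible⇐ {q} ps with project-complete n system ps
    ... | ρ , p ∷ ps′ = lookup (ρ Vec.++ q ∷ []) ∘ ix ,
      All.map (λ {c} → subst (0ℚ ℚ.≤_) (⟦⟧-compile ix c _)) (All.map⁻ ps′) ,
      subst₂ ℚ._≤_ (⟦m⟧ ρ q) (⟦⟧-compile ix obj _) (to (Sat-⊟ (compile ix obj) m-aff (ρ Vec.++ q ∷ [])) p)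

-- Both optima are attained

∈-vertices : ∀ {t} (v : Vertex t) → v ∈ vertices t
∈-vertices root        = here refl
∈-vertices {node k ts} (child i v) =
  there (∈-concatMap⁺ (λ i → map (child i) (vertices (ts i)))
    (lose (∈-allFin i) (∈-map⁺ (child i) (∈-vertices v))))

height : Tree → ℕ
height t = maxℕ 0 (map depth (vertices t))

depth≤height : ∀ {t} (v : Vertex t) → depth v ℕ.≤ height t
depth≤height {t} v = All.lookup (xs≤maxℕ 0 (map depth (vertices t))) (∈-map⁺ depth (∈-vertices v))

length-path : ∀ {t} (v : Vertex t) → length (path v) ≡ suc (depth v)
length-path root        = refl
length-path {node k ts} (child i v) =
  cong suc (trans (List.length-map (child {ts = ts} i) (path v)) (length-path v))

-- Whether `u` is saved is decided by picks `σ k` with `k < i` for a position `i` on its path, hence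
-- with `k < depth u`.
Saved-local : ∀ {t} {σ τ : Strategy t} n → (∀ {k} → k ℕ.< n → σ k ≡ τ k) →
              ∀ u → depth u ℕ.≤ n → Saved σ u → Saved τ u
Saved-local n σ≗τ u u≤n (i , k , σk≡) =
  i , k , trans (sym (σ≗τ (ℕ.<-≤-trans (Fin.toℕ<n k) (ℕ.≤-trans i≤u u≤n)))) σk≡
  where
    i≤u : toℕ i ℕ.≤ depth u
    i≤u = ℕ.s≤s⁻¹ (ℕ.≤-trans (Fin.toℕ<n i) (ℕ.≤-reflexive (length-path u)))

savedCount-local : ∀ {t} {σ τ : Strategy t} → (∀ {k} → k ℕ.< height t → σ k ≡ τ k) →
                   savedCount σ ≡ savedCount τ
savedCount-local {t} {σ} {τ} σ≗τ = cong length
  (List.filter-≐ (saved? σ) (saved? τ)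
    ( (λ {u} → Saved-local (height t) σ≗τ u (depth≤height u))
    , (λ {u} → Saved-local (height t) (sym ∘ σ≗τ) u (depth≤height u)))
    (vertices t))

-- Strategies are infinite sequences, but `savedCount` sees only the first `height t` picks. The
-- rest is padded with the source, which leaves a finite list to maximise over.
prefixes : ∀ t → ℕ → List (Strategy t)
prefixes t zero    = (λ _ → source t) ∷ []
prefixes t (suc n) = cartesianProductWith (λ v σ → λ { zero → v ; (suc k) → σ k }) (vertices t) (prefixes t n)

∈-prefixes : ∀ {t} n (σ : Strategy t) → ∃[ τ ] τ ∈ prefixes t n × (∀ {k} → k ℕ.< n → σ k ≡ τ k)
∈-prefixes zero    σ = _ , here refl , λ ()
∈-prefixes (suc n) σ with τ , τ∈ , σ≗τ ← ∈-prefixes n (σ ∘ suc) =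
  _ , ∈-cartesianProductWith⁺ _ (∈-vertices (σ 0)) τ∈ , λ { {zero} _ → refl ; {suc k} (s≤s k<n) → σ≗τ k<n }

OPT-exists : ∀ t → ∃[ opt ] IsOPT t opt
OPT-exists t = savedCount best , (best , tt , refl) , λ σ _ →
  let τ , τ∈ , σ≗τ = ∈-prefixes (height t) σ
  in subst (ℕ._≤ savedCount best) (sym (savedCount-local σ≗τ))
       (All.lookup (f[xs]≤f[argmax] {f = savedCount} (λ _ → source t) (prefixes t (height t))) τ∈)
  where best = argmax savedCount (λ _ → source t) (prefixes t (height t))

-- The optimum of (LP')

∑-mono : ∀ {A : Set} (us : List A) {f g : A → ℚ} → (∀ u → f u ℚ.≤ g u) → ∑ us f ℚ.≤ ∑ us g
∑-mono []       f≤g = ℚ.≤-refl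
∑-mono (u ∷ us) f≤g = ℚ.+-mono-≤ (f≤g u) (∑-mono us f≤g)

∑ᴱ : ∀ {A B : Set} → List A → (A → B) → Expr B
∑ᴱ us f = foldr (λ u e → var (f u) ⊕ e) (const 0ℚ) us

eval-∑ᴱ : ∀ {A B : Set} (us : List A) (f : A → B) z → eval z (∑ᴱ us f) ≡ ∑ us (z ∘ f)
eval-∑ᴱ []       f z = refl
eval-∑ᴱ (u ∷ us) f z = cong (z (f u) ℚ.+_) (eval-∑ᴱ us f z)

_≼_ : ∀ {A} → Expr A → Expr A → Expr A
d ≼ e = e ⊕ neg d

≼⇔≤ : ∀ {A} (z : A → ℚ) (d e : Expr A) {p q} → eval z d ≡ p → eval z e ≡ q →
      0ℚ ℚ.≤ eval z (d ≼ e) ⇔ p ℚ.≤ q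
≼⇔≤ z d e refl refl = 0≤q-p⇔p≤q (eval z d) (eval z e)

module _ (t : Tree) where
  private
    V = Vertex t
    vs = vertices t

    Variable : Set
    Variable = V ⊎ V

    pattern X v = inj₁ v
    pattern Y v = inj₂ v

    variables : List Variable
    variables = map inj₁ vs ++ map inj₂ vs

    ∈-variables : ∀ a → a ∈ variables
    ∈-variables (X v) = ∈-++⁺ˡ (∈-map⁺ inj₁ (∈-vertices v))
    ∈-variables (Y v) = ∈-++⁺ʳ (map inj₁ vs) (∈-map⁺ inj₂ (∈-vertices v))

    -- Hartke's constraints range over all `j`, and elimination needs finitely many. The cut is at
    -- `1 + height t`, one layer beyond the last nonempty one: this constraint stands for all later
    -- ones, which bound the path alone.
    vertexLayers : List (V × ℕ)
    vertexLayers = filter (λ (v , j) → depth v ℕ.<? j) (cartesianProduct vs (upTo (2 ℕ.+ height t)))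

    Hartke : V × ℕ → Expr Variable
    Hartke (v , j) = ∑ᴱ (filter (hartkeSet? v j) vs) inj₁ ≼ const 1ℚ

    vertexConstraints : List (V → Expr Variable)
    vertexConstraints =
      (λ v → var (Y v) ≼ ∑ᴱ (path v) inj₁) ∷
      (λ v → const 0ℚ ≼ var (X v)) ∷
      (λ v → var (X v) ≼ const 1ℚ) ∷
      (λ v → const 0ℚ ≼ var (Y v)) ∷
      (λ v → var (Y v) ≼ const 1ℚ) ∷ []

    constraints : List (Expr Variable)
    constraints = (var (X (source t)) ≼ const 0ℚ) ∷
      map Hartke vertexLayers ++ cartesianProductWith (λ c v → c v) vertexConstraints vs

    objective : Expr Variable
    objective = ∑ᴱ vs inj₂

    sound : ∀ {z} → Feasible constraints z → LP′-Feasible t (z ∘ inj₁) (z ∘ inj₂)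
    sound {z} (source≤0 ∷ ps) = record
      { hartke   = hartke
      ; y≤∑x     = λ v → to (≼⇔≤ z (var (Y v)) (∑ᴱ (path v) inj₁) refl (eval-∑ᴱ (path v) inj₁ z)) (at (here refl) v)
      ; 0≤x      = 0≤x
      ; x≤1      = λ v → to (≼⇔≤ z (var (X v)) (const 1ℚ) refl refl) (at (there (there (here refl))) v)
      ; 0≤y      = λ v → to (≼⇔≤ z (const 0ℚ) (var (Y v)) refl refl) (at (there (there (there (here refl)))) v)
      ; y≤1      = λ v → to (≼⇔≤ z (var (Y v)) (const 1ℚ) refl refl) (at (there (there (there (there (here refl))))) v)
      ; x-source = ℚ.≤-antisym (to (≼⇔≤ z (var (X (source t))) (const 0ℚ) refl refl) source≤0) (0≤x (source t))
      }
      where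
        at : ∀ {c} → c ∈ vertexConstraints → ∀ v → 0ℚ ℚ.≤ eval z (c v)
        at c∈ v = All.lookup (All.++⁻ʳ (map Hartke vertexLayers) ps)
          (∈-cartesianProductWith⁺ (λ c v → c v) c∈ (∈-vertices v))

        0≤x : ∀ v → 0ℚ ℚ.≤ z (X v)
        0≤x v = to (≼⇔≤ z (const 0ℚ) (var (X v)) refl refl) (at (there (here refl)) v)

        hartke-low : ∀ v j → j ℕ.≤ 1 ℕ.+ height t → depth v ℕ.< j →
                     ∑ (filter (hartkeSet? v j) vs) (z ∘ inj₁) ℚ.≤ 1ℚ
        hartke-low v j j≤ v<j =
          to (≼⇔≤ z (∑ᴱ us inj₁) (const 1ℚ) (eval-∑ᴱ us inj₁ z) refl)
            (All.lookup (All.++⁻ˡ (map Hartke vertexLayers) ps)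
              (∈-map⁺ Hartke
                (∈-filter⁺ (λ (v , j) → depth v ℕ.<? j)
                  (∈-cartesianProduct⁺ (∈-vertices v) (∈-upTo⁺ (s≤s j≤))) v<j)))
          where us = filter (hartkeSet? v j) vs

        -- Layers below the deepest one are all empty.
        hartke : ∀ v j → depth v ℕ.< j → ∑ (filter (hartkeSet? v j) vs) (z ∘ inj₁) ℚ.≤ 1ℚ
        hartke v j v<j with j ℕ.≤? 1 ℕ.+ height t
        ... | yes j≤ = hartke-low v j j≤ v<j
        ... | no  j≰ =
          subst (λ us → ∑ us (z ∘ inj₁) ℚ.≤ 1ℚ)
            (List.filter-≐ (hartkeSet? v (1 ℕ.+ height t)) (hartkeSet? v j)
              ( (λ { (inj₁ u∈) → inj₁ u∈ ; {u} (inj₂ (_ , u≡)) → contradiction (depth≤height u) (ℕ.<⇒≱ (ℕ.≤-reflexive (sym u≡))) })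
              , (λ { (inj₁ u∈) → inj₁ u∈ ; {u} (inj₂ (_ , u≡)) → contradiction
                    (ℕ.≤-trans (ℕ.≤-reflexive (sym u≡)) (ℕ.≤-trans (depth≤height u) (ℕ.n≤1+n _))) j≰ }) )
              vs)
            (hartke-low v (1 ℕ.+ height t) ℕ.≤-refl (s≤s (depth≤height v)))

    complete : ∀ {x y} → LP′-Feasible t x y → Feasible constraints [ x , y ]
    complete {x} {y} p =
      from (≼⇔≤ z (var (X (source t))) (const 0ℚ) refl refl) (ℚ.≤-reflexive x-source) ∷
      All.++⁺
        (All.map⁺ (All.tabulate {xs = vertexLayers} λ {(v , j)} vj∈ →
          let us = filter (hartkeSet? v j) vs
          in from (≼⇔≤ z (∑ᴱ us inj₁) (const 1ℚ) (eval-∑ᴱ us inj₁ z) refl)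
               (hartke v j (proj₂ (∈-filter⁻ (λ (v , j) → depth v ℕ.<? j) {xs = cartesianProduct vs (upTo (2 ℕ.+ height t))} vj∈)))))
        (All.tabulate λ e∈ →
          let c , v , c∈ , _ , e≡ = ∈-cartesianProductWith⁻ (λ c v → c v) vertexConstraints vs e∈
          in subst (λ e → 0ℚ ℚ.≤ eval z e) (sym e≡) (All.lookup (vertexwise v) c∈))
      where
        open LP′-Feasible p
        z = [ x , y ]
        vertexwise : ∀ v → All (λ c → 0ℚ ℚ.≤ eval z (c v)) vertexConstraints
        vertexwise v =
          from (≼⇔≤ z (var (Y v)) (∑ᴱ (path v) inj₁) refl (eval-∑ᴱ (path v) inj₁ z)) (y≤∑x v) ∷
          from (≼⇔≤ z (const 0ℚ) (var (X v)) refl refl) (0≤x v) ∷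
          from (≼⇔≤ z (var (X v)) (const 1ℚ) refl refl) (x≤1 v) ∷
          from (≼⇔≤ z (const 0ℚ) (var (Y v)) refl refl) (0≤y v) ∷
          from (≼⇔≤ z (var (Y v)) (const 1ℚ) refl refl) (y≤1 v) ∷ []

  private
    bounded : ∀ {z} → Feasible constraints z → eval z objective ℚ.≤ ∑ vs (λ _ → 1ℚ)
    bounded {z} pz =
      subst (ℚ._≤ ∑ vs (λ _ → 1ℚ)) (sym (eval-∑ᴱ vs inj₂ z)) (∑-mono vs (LP′-Feasible.y≤1 (sound {z} pz)))

    optimum : ∀ {x y} → LP′-Feasible t x y →
              ∃[ z ] Feasible constraints z × (∀ {z′} → Feasible constraints z′ → eval z′ objective ℚ.≤ eval z objective)
    optimum {x} {y} p = linearProgram-maximum variables ∈-variables constraints objective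
      {[ x , y ]} {∑ vs (λ _ → 1ℚ)} (complete {x} {y} p) (λ {z} → bounded {z})

  LP′-exists : ∀ {x y} → LP′-Feasible t x y → ∃[ lp ] IsLP′ t lp
  LP′-exists {x} {y} p₀ = result (optimum p₀)
    where
      result : ∃[ z ] Feasible constraints z × (∀ {z′} → Feasible constraints z′ → eval z′ objective ℚ.≤ eval z objective) →
        ∃[ lp ] IsLP′ t lp
      result (z , pz , z-max) = ∑ vs (z ∘ inj₂) , ((z ∘ inj₁ , z ∘ inj₂) , sound {z} pz , refl) ,
        λ (x , y) p → subst₂ ℚ._≤_ (eval-∑ᴱ vs inj₂ [ x , y ]) (eval-∑ᴱ vs inj₂ z) (z-max {[ x , y ]} (complete {x} {y} p))

-- Sums over trees

module _ where
  open import Data.Nat.Base using (_+_; _*_; _≤_; _<_)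

  sum-mono : ∀ {n} {f g : Fin n → ℕ} → (∀ i → f i ≤ g i) → sum f ≤ sum g
  sum-mono {zero}  f≤g = z≤n
  sum-mono {suc n} f≤g = ℕ.+-mono-≤ (f≤g zero) (sum-mono (f≤g ∘ suc))

  term≤sum : ∀ {n} (f : Fin n → ℕ) i → f i ≤ sum f
  term≤sum f zero    = ℕ.m≤m+n (f zero) _
  term≤sum f (suc i) = ℕ.≤-trans (term≤sum (f ∘ suc) i) (ℕ.m≤n+m _ (f zero))

  sum-const : ∀ n c → sum {n} (λ _ → c) ≡ n * c
  sum-const zero    c = refl
  sum-const (suc n) c = cong (c +_) (sum-const n c)

  sum-zero : ∀ {n} {f : Fin n → ℕ} → (∀ i → f i ≡ 0) → sum f ≡ 0
  sum-zero {n} f≡0 = trans (sum-cong-≗ f≡0) (trans (sum-const n 0) (ℕ.*-zeroʳ n))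

  sum-single : ∀ {n} (f : Fin n → ℕ) i → (∀ j → j ≢ i → f j ≡ 0) → sum f ≡ f i
  sum-single f zero    f≡0 =
    trans (cong (f zero +_) (sum-zero (λ j → f≡0 (suc j) λ ()))) (ℕ.+-identityʳ _)
  sum-single f (suc i) f≡0 =
    cong₂ _+_ (f≡0 zero λ ()) (sum-single (f ∘ suc) i λ j j≢i → f≡0 (suc j) (j≢i ∘ Fin.suc-injective))

  -- Iverson bracket.
  ⟨_⟩ : ∀ {a} {P : Set a} → Dec P → ℕ
  ⟨ p? ⟩ = if does p? then 1 else 0

  ⟨⟩-yes : ∀ {a} {P : Set a} (p? : Dec P) → P → ⟨ p? ⟩ ≡ 1
  ⟨⟩-yes (yes _) p = refl
  ⟨⟩-yes (no ¬p) p = contradiction p ¬p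

  ⟨⟩-no : ∀ {a} {P : Set a} (p? : Dec P) → ¬ P → ⟨ p? ⟩ ≡ 0
  ⟨⟩-no (yes p) ¬p = contradiction p ¬p
  ⟨⟩-no (no _)  ¬p = refl

  ⟨⟩-cong : ∀ {a b} {P : Set a} {Q : Set b} (p? : Dec P) (q? : Dec Q) → (P → Q) → (Q → P) → ⟨ p? ⟩ ≡ ⟨ q? ⟩
  ⟨⟩-cong (yes p) q? f g = sym (⟨⟩-yes q? (f p))
  ⟨⟩-cong (no ¬p) q? f g = sym (⟨⟩-no q? (¬p ∘ g))

  ⟨⟩*≤ : ∀ {a} {P : Set a} (p? : Dec P) {m n} → (P → m ≤ n) → ⟨ p? ⟩ * m ≤ n
  ⟨⟩*≤ (yes p) m≤n = ℕ.≤-trans (ℕ.≤-reflexive (ℕ.*-identityˡ _)) (m≤n p)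
  ⟨⟩*≤ (no _)  m≤n = z≤n

  -- Recursion on the tree instead of a sum over the list `vertices`, so that totals over the
  -- concrete instance split by computation. `sumᴸ-vertices` links the two.
  total : (t : Tree) → (Vertex t → ℕ) → ℕ
  total (node k ts) f = f root + sum (λ i → total (ts i) (f ∘ child i))

  total-cong : ∀ t {f g} → (∀ v → f v ≡ g v) → total t f ≡ total t g
  total-cong (node k ts) f≗g = cong₂ _+_ (f≗g root) (sum-cong-≗ λ i → total-cong (ts i) (f≗g ∘ child i))

  total-mono : ∀ t {f g} → (∀ v → f v ≤ g v) → total t f ≤ total t g
  total-mono (node k ts) f≤g = ℕ.+-mono-≤ (f≤g root) (sum-mono λ i → total-mono (ts i) (f≤g ∘ child i))

  total-zero : ∀ t {f} → (∀ v → f v ≡ 0) → total t f ≡ 0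
  total-zero (node k ts) f≡0 = cong₂ _+_ (f≡0 root) (sum-zero λ i → total-zero (ts i) (f≡0 ∘ child i))

  total-+ : ∀ t f g → total t (λ v → f v + g v) ≡ total t f + total t g
  total-+ (node k ts) f g = begin
    f root + g root + sum (λ i → total (ts i) (λ v → f (child i v) + g (child i v)))
      ≡⟨ cong (f root + g root +_) (trans (sum-cong-≗ λ i → total-+ (ts i) (f ∘ child i) (g ∘ child i)) (∑-distrib-+ F G)) ⟩
    f root + g root + (sum F + sum G)
      ≡⟨ solve 4 (λ a b c d → a :+ b :+ (c :+ d) := a :+ c :+ (b :+ d)) refl (f root) (g root) (sum F) (sum G) ⟩
    f root + sum F + (g root + sum G) ∎
    where
      open ≡-Reasoning
      open ℕ-Solver
      F = λ i → total (ts i) (f ∘ child i)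
      G = λ i → total (ts i) (g ∘ child i)

  total-* : ∀ t c f → total t (λ v → c * f v) ≡ c * total t f
  total-* (node k ts) c f = begin
    c * f root + sum (λ i → total (ts i) (λ v → c * f (child i v)))
      ≡⟨ cong (c * f root +_) (sum-cong-≗ λ i → total-* (ts i) c (f ∘ child i)) ⟩
    c * f root + sum (λ i → c * total (ts i) (f ∘ child i))
      ≡⟨ cong (c * f root +_) (*-distribˡ-sum c (λ i → total (ts i) (f ∘ child i))) ⟨
    c * f root + c * sum (λ i → total (ts i) (f ∘ child i))
      ≡⟨ ℕ.*-distribˡ-+ c (f root) _ ⟨
    c * total (node k ts) f ∎
    where open ≡-Reasoning

  total-sum : ∀ t {n} (f : Fin n → Vertex t → ℕ) → total t (λ v → sum (λ k → f k v)) ≡ sum (λ k → total t (f k))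
  total-sum t {zero}  f = total-zero t λ _ → refl
  total-sum t {suc n} f = trans (total-+ t (f zero) _) (cong (total t (f zero) +_) (total-sum t (f ∘ suc)))

  sumᴸ-vertices : ∀ t f → sumᴸ (map f (vertices t)) ≡ total t f
  sumᴸ-vertices (node k ts) f = cong (f root +_) (begin
    sumᴸ (map f (concatMap below (allFin k)))
      ≡⟨ cong (sumᴸ ∘ map f ∘ List.concat) (List.map-tabulate id below) ⟩
    sumᴸ (map f (List.concat (List.tabulate below)))
      ≡⟨ blocks below ⟩
    sum (λ i → sumᴸ (map f (below i)))
      ≡⟨ sum-cong-≗ (λ i → trans (cong sumᴸ (sym (List.map-∘ (vertices (ts i))))) (sumᴸ-vertices (ts i) (f ∘ child i))) ⟩
    sum (λ i → total (ts i) (f ∘ child i)) ∎)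
    where
      open ≡-Reasoning
      below : ∀ i → List (Vertex (node k ts))
      below i = map (child i) (vertices (ts i))
      blocks : ∀ {n} (b : Fin n → List (Vertex (node k ts))) →
               sumᴸ (map f (List.concat (List.tabulate b))) ≡ sum (λ i → sumᴸ (map f (b i)))
      blocks {zero}  b = refl
      blocks {suc n} b = begin
        sumᴸ (map f (b zero ++ rest))            ≡⟨ cong sumᴸ (List.map-++ f (b zero) rest) ⟩
        sumᴸ (map f (b zero) ++ map f rest)      ≡⟨ sumᴸ-++ (map f (b zero)) (map f rest) ⟩
        sumᴸ (map f (b zero)) + sumᴸ (map f rest)  ≡⟨ cong (sumᴸ (map f (b zero)) +_) (blocks (b ∘ suc)) ⟩
        sumᴸ (map f (b zero)) + sum (λ i → sumᴸ (map f (b (suc i)))) ∎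
        where rest = List.concat (List.tabulate (b ∘ suc))

  sumᴸ-filter : ∀ {A : Set} {P : Pred A 0ℓ} (P? : Decidable P) (h : A → ℕ) us →
                sumᴸ (map h (filter P? us)) ≡ sumᴸ (map (λ u → ⟨ P? u ⟩ * h u) us)
  sumᴸ-filter P? h []       = refl
  sumᴸ-filter P? h (u ∷ us) with P? u
  ... | yes _ = cong₂ _+_ (sym (ℕ.*-identityˡ (h u))) (sumᴸ-filter P? h us)
  ... | no  _ = sumᴸ-filter P? h us

  -- A union bound for the saved vertices

  size : Tree → ℕ
  size t = total t λ _ → 1

  length≡sumᴸ : ∀ {A : Set} (us : List A) → length us ≡ sumᴸ (map (λ _ → 1) us)
  length≡sumᴸ []       = refl
  length≡sumᴸ (u ∷ us) = cong suc (length≡sumᴸ us)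

  savedCount≡total : ∀ {t} (σ : Strategy t) → savedCount σ ≡ total t (λ u → ⟨ saved? σ u ⟩)
  savedCount≡total {t} σ = begin
    savedCount σ                                              ≡⟨ length≡sumᴸ (filter (saved? σ) (vertices t)) ⟩
    sumᴸ (map (λ _ → 1) (filter (saved? σ) (vertices t)))     ≡⟨ sumᴸ-filter (saved? σ) (λ _ → 1) (vertices t) ⟩
    sumᴸ (map (λ u → ⟨ saved? σ u ⟩ * 1) (vertices t))        ≡⟨ sumᴸ-vertices t _ ⟩
    total t (λ u → ⟨ saved? σ u ⟩ * 1)                        ≡⟨ total-cong t (λ u → ℕ.*-identityʳ _) ⟩
    total t (λ u → ⟨ saved? σ u ⟩)                            ∎
    where open ≡-Reasoning

  root∈path : ∀ {k ts} (u : Vertex (node k ts)) → root ∈ path u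
  root∈path root        = here refl
  root∈path (child i u) = here refl

  child∈path⁺ : ∀ {k} (ts : Fin k → Tree) {i : Fin k} {v u : Vertex (ts i)} → v ∈ path u →
    child {ts = ts} i v ∈ path (child i u)
  child∈path⁺ ts v∈ = there (∈-map⁺ (child _) v∈)

  child∈path⁻ : ∀ {k} (ts : Fin k → Tree) {i : Fin k} {v u : Vertex (ts i)} → child {ts = ts} i v ∈ path (child i u) →
    v ∈ path u
  child∈path⁻ ts (there cv∈) with ∈-map⁻ (child _) cv∈
  ... | _ , v∈ , refl = v∈

  child∈path⇒≡ : ∀ {k} (ts : Fin k → Tree) {i j : Fin k} {v : Vertex (ts i)} {u : Vertex (ts j)} →
                  child {ts = ts} i v ∈ path (child j u) → i ≡ j
  child∈path⇒≡ ts (there cv∈) with ∈-map⁻ (child _) cv∈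
  ... | _ , v∈ , refl = refl

  -- The sum over `T_v`, found by descending to `v`. A pick inside a branch is thereby valued within
  -- that branch.
  subtotal : (t : Tree) → (Vertex t → ℕ) → Vertex t → ℕ
  subtotal t           g root        = total t g
  subtotal (node k ts) g (child i v) = subtotal (ts i) (g ∘ child i) v

  subtotal≡total : ∀ t g v → subtotal t g v ≡ total t (λ u → ⟨ v ∈? path u ⟩ * g u)
  subtotal≡total (node k ts) g root = total-cong (node k ts) λ u →
    sym (trans (cong (_* g u) (⟨⟩-yes (root ∈? path u) (root∈path u))) (ℕ.*-identityˡ (g u)))
  subtotal≡total (node k ts) g (child i v) = begin
    subtotal (ts i) (g ∘ child i) v
      ≡⟨ subtotal≡total (ts i) (g ∘ child i) v ⟩
    total (ts i) (λ u → ⟨ v ∈? path u ⟩ * g (child {ts = ts} i u))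
      ≡⟨ total-cong (ts i) (λ u → cong (_* g (child {ts = ts} i u))
           (⟨⟩-cong (v ∈? path u) (child {ts = ts} i v ∈? path (child {ts = ts} i u)) (child∈path⁺ ts) (child∈path⁻ ts))) ⟩
    total (ts i) (λ u → ⟨ child {ts = ts} i v ∈? path (child {ts = ts} i u) ⟩ * g (child {ts = ts} i u))
      ≡⟨ sum-single (λ j → total (ts j) (λ u → ⟨ child {ts = ts} i v ∈? path (child {ts = ts} j u) ⟩ * g (child {ts = ts} j u))) i
           (λ j j≢i → total-zero (ts j) λ u → cong (_* g (child {ts = ts} j u))
           (⟨⟩-no (child {ts = ts} i v ∈? path (child {ts = ts} j u)) (j≢i ∘ sym ∘ child∈path⇒≡ ts))) ⟨
    sum (λ j → total (ts j) (λ u → ⟨ child {ts = ts} i v ∈? path (child {ts = ts} j u) ⟩ * g (child {ts = ts} j u)))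
      ≡⟨ cong (λ c → c * g root +
             sum (λ j → total (ts j) (λ u → ⟨ child {ts = ts} i v ∈? path (child {ts = ts} j u) ⟩ * g (child {ts = ts} j u))))
           (⟨⟩-no (child {ts = ts} i v ∈? path root) λ { (here ()) ; (there ()) }) ⟨
    total (node k ts) (λ u → ⟨ child {ts = ts} i v ∈? path u ⟩ * g u) ∎
    where open ≡-Reasoning

  subtotal≤total : ∀ t g v → subtotal t g v ≤ total t g
  subtotal≤total t           g root        = ℕ.≤-refl
  subtotal≤total (node k ts) g (child i v) = ℕ.≤-trans (subtotal≤total (ts i) (g ∘ child i) v)
    (ℕ.≤-trans (term≤sum (λ i → total (ts i) (g ∘ child i)) i) (ℕ.m≤n+m _ (g root)))

  depth-lookup-path : ∀ {t} (u : Vertex t) i → depth (List.lookup (path u) i) ≡ toℕ i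
  depth-lookup-path root        zero    = refl
  depth-lookup-path (child c u) zero    = refl
  depth-lookup-path {node k ts} (child c u) (suc i) = below (path u) id (depth-lookup-path u) i
    where
      -- `g` generalises the position, which is shifted by the recursion along the list.
      below : ∀ us (g : ℕ → ℕ) → (∀ i → depth (List.lookup us i) ≡ g (toℕ i)) →
              ∀ i → depth (List.lookup (map (child {ts = ts} c) us) i) ≡ suc (g (toℕ i))
      below (u ∷ us) g us≡ zero    = cong suc (us≡ zero)
      below (u ∷ us) g us≡ (suc i) = below us (g ∘ suc) (us≡ ∘ suc) i

  -- The bracket discards picks that come too late: position and depth agree on a path, so `Saved`
  -- can use `σ k` only if `k < depth (σ k)`.
  gain : ∀ {t} → Strategy t → (Vertex t → ℕ) → ℕ → ℕ
  gain {t} σ g k = ⟨ k ℕ.<? depth (σ k) ⟩ * subtotal t g (σ k)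

  module _ {t} (σ : Strategy t) (g : Vertex t → ℕ) (H : ℕ) (g≡0 : ∀ u → H < depth u → g u ≡ 0) where

    private
      share : Fin H → Vertex t → ℕ
      share k u = ⟨ toℕ k ℕ.<? depth (σ (toℕ k)) ⟩ * (⟨ σ (toℕ k) ∈? path u ⟩ * g u)

      -- The pick that saves `u` has index below `depth u`. So for `depth u ≤ H` it is among the
      -- first `H`, and its share alone is `g u`; deeper down `g` vanishes.
      saved≤shares : ∀ u → ⟨ saved? σ u ⟩ * g u ≤ sum (λ k → share k u)
      saved≤shares u with depth u ℕ.≤? H
      ... | no  u≰H =
        ℕ.≤-trans (ℕ.≤-reflexive (trans (cong (⟨ saved? σ u ⟩ *_) (g≡0 u (ℕ.≰⇒> u≰H))) (ℕ.*-zeroʳ ⟨ saved? σ u ⟩))) z≤n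
      ... | yes u≤H with saved? σ u
      ...   | no  _ = z≤n
      ...   | yes (i , k , σk≡) = ℕ.≤-trans
        (ℕ.≤-reflexive (sym (trans (cong₂ (λ a b → a * (b * g u)) k<depth k∈path) (ℕ.*-identityˡ (1 * g u)))))
        (ℕ.≤-trans (ℕ.≤-reflexive (cong (λ k → ⟨ k ℕ.<? depth (σ k) ⟩ * (⟨ σ k ∈? path u ⟩ * g u)) (sym (Fin.toℕ-fromℕ< k<H))))
          (ℕ.≤-trans (term≤sum (λ k → share k u) (fromℕ< k<H)) ℕ.≤-refl))
        where
          k<H : toℕ k < H
          k<H =
            ℕ.<-≤-trans (Fin.toℕ<n k) (ℕ.≤-trans (ℕ.s≤s⁻¹ (ℕ.≤-trans (Fin.toℕ<n i) (ℕ.≤-reflexive (length-path u)))) u≤H)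
          k<depth : ⟨ toℕ k ℕ.<? depth (σ (toℕ k)) ⟩ ≡ 1
          k<depth = ⟨⟩-yes (toℕ k ℕ.<? depth (σ (toℕ k)))
            (subst (toℕ k <_) (sym (trans (cong depth σk≡) (depth-lookup-path u i))) (Fin.toℕ<n k))
          k∈path : ⟨ σ (toℕ k) ∈? path u ⟩ ≡ 1
          k∈path = ⟨⟩-yes (σ (toℕ k) ∈? path u) (subst (_∈ path u) (sym σk≡) (∈-lookup i))

      total-share : ∀ k → total t (share k) ≡ gain σ g (toℕ k)
      total-share k = trans (total-* t ⟨ toℕ k ℕ.<? depth (σ (toℕ k)) ⟩ _)
        (cong (⟨ toℕ k ℕ.<? depth (σ (toℕ k)) ⟩ *_) (sym (subtotal≡total t g (σ (toℕ k)))))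

    -- Union bound over the picks: each saves at most the part of g below it.
    savedTotal≤gains : total t (λ u → ⟨ saved? σ u ⟩ * g u) ≤ sum {H} (λ k → gain σ g (toℕ k))
    savedTotal≤gains = ℕ.≤-trans (total-mono t saved≤shares)
      (ℕ.≤-reflexive (trans (total-sum t share) (sum-cong-≗ {H} total-share)))

    -- At least `total t g - H * B` marked vertices burn; the form with sums avoids truncated
    -- subtraction. Pointwise it rests on `(1 - saved) * (1 - g) ≥ 0`.
    savedCount-bound : (∀ u → g u ≤ 1) → ∀ B → (∀ k → k < depth (σ k) → subtotal t g (σ k) ≤ B) →
                       savedCount σ + total t g ≤ size t + H * B
    savedCount-bound g≤1 B gain≤B = begin
      savedCount σ + total t g
        ≡⟨ cong (_+ total t g) (savedCount≡total σ) ⟩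
      total t (λ u → ⟨ saved? σ u ⟩) + total t g
        ≡⟨ total-+ t _ g ⟨
      total t (λ u → ⟨ saved? σ u ⟩ + g u)
        ≤⟨ total-mono t pointwise ⟩
      total t (λ u → 1 + ⟨ saved? σ u ⟩ * g u)
        ≡⟨ total-+ t (λ _ → 1) _ ⟩
      size t + total t (λ u → ⟨ saved? σ u ⟩ * g u)
        ≤⟨ ℕ.+-monoʳ-≤ (size t) savedTotal≤gains ⟩
      size t + sum {H} (λ k → gain σ g (toℕ k))
        ≤⟨ ℕ.+-monoʳ-≤ (size t) (ℕ.≤-trans (sum-mono {H} gains≤) (ℕ.≤-reflexive (sum-const H B))) ⟩
      size t + H * B ∎
      where
        open ℕ.≤-Reasoning
        pointwise : ∀ u → ⟨ saved? σ u ⟩ + g u ≤ 1 + ⟨ saved? σ u ⟩ * g u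
        pointwise u with saved? σ u
        ... | yes _ = ℕ.≤-reflexive (cong suc (sym (ℕ.+-identityʳ (g u))))
        ... | no  _ = g≤1 u
        gains≤ : ∀ k → gain σ g (toℕ k) ≤ B
        gains≤ k = ⟨⟩*≤ (toℕ k ℕ.<? depth (σ (toℕ k))) (gain≤B (toℕ k))

  -- Hartke sums and the objective by recursion on the tree

  layer : (t : Tree) → (Vertex t → ℕ) → ℕ → ℕ
  layer (node k ts) h zero    = h root
  layer (node k ts) h (suc j) = sum λ i → layer (ts i) (h ∘ child i) j

  hartkeTotal : (t : Tree) → (Vertex t → ℕ) → Vertex t → ℕ → ℕ
  hartkeTotal t h v j = total t (λ u → ⟨ hartkeSet? v j u ⟩ * h u)

  layer≡total : ∀ t h j → total t (λ u → ⟨ depth u ℕ.≟ j ⟩ * h u) ≡ layer t h j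
  layer≡total (node k ts) h zero    = trans
    (cong (1 * h root +_) (sum-zero λ i → total-zero (ts i) λ u → refl))
    (trans (ℕ.+-identityʳ _) (ℕ.*-identityˡ _))
  layer≡total (node k ts) h (suc j) = sum-cong-≗ λ i → trans
    (total-cong (ts i) λ u → cong (_* h (child i u)) (⟨⟩-cong (suc (depth u) ℕ.≟ suc j) (depth u ℕ.≟ j) ℕ.suc-injective (cong suc)))
    (layer≡total (ts i) (h ∘ child i) j)

  hartkeTotal-root : ∀ {k ts} h j →
    hartkeTotal (node k ts) h root (suc j) ≡ h root + layer (node k ts) h (suc j)
  hartkeTotal-root {k} {ts} h j = cong₂ _+_
    (trans (cong (_* h root) (⟨⟩-yes (hartkeSet? {node k ts} root (suc j) root) (inj₁ (here refl)))) (ℕ.*-identityˡ _))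
    (sum-cong-≗ λ i → trans
      (total-cong (ts i) λ u → cong (_* h (child i u))
        (⟨⟩-cong (hartkeSet? root (suc j) (child {ts = ts} i u)) (depth u ℕ.≟ j)
          (λ { (inj₁ (here ())) ; (inj₁ (there ())) ; (inj₂ (_ , u≡)) → ℕ.suc-injective u≡ })
          (λ u≡ → inj₂ (here refl , cong suc u≡))))
      (layer≡total (ts i) (h ∘ child i) j))

  hartkeTotal-child : ∀ {k ts} h (i : Fin k) (v : Vertex (ts i)) j →
    hartkeTotal (node k ts) h (child i v) (suc j) ≡ h root + hartkeTotal (ts i) (h ∘ child i) v j
  hartkeTotal-child {k} {ts} h i v j = cong₂ _+_
    (trans (cong (_* h root) (⟨⟩-yes (hartkeSet? (child {ts = ts} i v) (suc j) root) (inj₁ (here refl)))) (ℕ.*-identityˡ _))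
    (trans
      (sum-single (λ c → total (ts c) (λ u → ⟨ hartkeSet? (child {ts = ts} i v) (suc j) (child c u) ⟩ * h (child c u))) i
        (λ c c≢i → total-zero (ts c) λ u → cong (_* h (child c u)) (⟨⟩-no (hartkeSet? (child {ts = ts} i v) (suc j) (child c u))
          λ { (inj₁ u∈) → c≢i (child∈path⇒≡ ts u∈) ; (inj₂ (v∈ , _)) → c≢i (sym (child∈path⇒≡ ts v∈)) })))
      (total-cong (ts i) λ u → cong (_* h (child i u))
        (⟨⟩-cong (hartkeSet? (child {ts = ts} i v) (suc j) (child i u)) (hartkeSet? v j u)
          (λ { (inj₁ u∈) → inj₁ (child∈path⁻ ts u∈) ; (inj₂ (v∈ , u≡)) → inj₂ (child∈path⁻ ts v∈ , ℕ.suc-injective u≡) })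
          (λ { (inj₁ u∈) → inj₁ (child∈path⁺ ts u∈) ; (inj₂ (v∈ , u≡)) → inj₂ (child∈path⁺ ts v∈ , cong suc u≡) }))))

  -- s is the weight already collected above the root of t. The bound is 2 because x = h / 2.
  record HartkeBounded (s : ℕ) (t : Tree) (h : Vertex t → ℕ) : Set where
    constructor hartkeBounded
    field
      hartke≤2 : ∀ v j → depth v < j → s + hartkeTotal t h v j ≤ 2

  open HartkeBounded

  -- For `v` inside a child's subtree the Hartke sum is the root's weight plus the sum within that
  -- subtree. Only the constraints at the root itself are new.
  hartkeBounded-node : ∀ {s k ts h} → (∀ j → s + h root + layer (node k ts) h (suc j) ≤ 2) →
    (∀ i → HartkeBounded (s + h root) (ts i) (h ∘ child i)) → HartkeBounded s (node k ts) h
  hartkeBounded-node {s} {k} {ts} {h} at-root below = hartkeBounded λ where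
    root        (suc j) _         → ℕ.≤-trans
      (ℕ.≤-reflexive (trans (cong (s +_) (hartkeTotal-root {ts = ts} h j)) (sym (ℕ.+-assoc s (h root) _))))
      (at-root j)
    (child i v) (suc j) (s≤s v<j) → ℕ.≤-trans
      (ℕ.≤-reflexive (trans (cong (s +_) (hartkeTotal-child {ts = ts} h i v j)) (sym (ℕ.+-assoc s (h root) _))))
      (hartke≤2 (below i) v j v<j)

  -- A Hartke sum is part of the whole weight. This crude bound is enough for the legs and for every
  -- `D i`.
  hartkeBounded-total : ∀ {s t h} → s + total t h ≤ 2 → HartkeBounded s t h
  hartkeBounded-total {s} {t} {h} ≤2 = hartkeBounded λ v j _ → ℕ.≤-trans
    (ℕ.+-monoʳ-≤ s (total-mono t λ u → ⟨⟩*≤ (hartkeSet? v j u) λ _ → ℕ.≤-refl)) ≤2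

  pathTotal : ∀ {t} → (Vertex t → ℕ) → Vertex t → ℕ
  pathTotal h v = sumᴸ (map h (path v))

  pathTotal-child : ∀ {k ts} h (i : Fin k) (v : Vertex (ts i)) →
    pathTotal {node k ts} h (child i v) ≡ h root + pathTotal (h ∘ child i) v
  pathTotal-child h i v = cong (λ us → h root + sumᴸ us) (sym (List.map-∘ (path v)))

  ≤pathTotal : ∀ {t} h (v : Vertex t) → h v ≤ pathTotal h v
  ≤pathTotal             h root        = ℕ.m≤m+n (h root) 0
  ≤pathTotal {node k ts} h (child i v) = ℕ.≤-trans (≤pathTotal (h ∘ child i) v)
    (ℕ.≤-trans (ℕ.m≤n+m _ (h root)) (ℕ.≤-reflexive (sym (pathTotal-child {ts = ts} h i v))))

  -- `P_v` is contained in each Hartke set of `v`. This lets `y` be the full path sum without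
  -- exceeding 1.
  pathTotal≤hartkeTotal : ∀ {t} h (v : Vertex t) j → depth v < j → pathTotal h v ≤ hartkeTotal t h v j
  pathTotal≤hartkeTotal {node k ts} h root (suc j) _ = ℕ.≤-trans
    (ℕ.+-monoʳ-≤ (h root) z≤n) (ℕ.≤-reflexive (sym (hartkeTotal-root {ts = ts} h j)))
  pathTotal≤hartkeTotal {node k ts} h (child i v) (suc j) (s≤s v<j) = ℕ.≤-trans
    (ℕ.≤-reflexive (pathTotal-child {ts = ts} h i v))
    (ℕ.≤-trans (ℕ.+-monoʳ-≤ (h root) (pathTotal≤hartkeTotal (h ∘ child i) v j v<j))
      (ℕ.≤-reflexive (sym (hartkeTotal-child {ts = ts} h i v j))))

  -- Twice the objective value, when weight s has been collected above the root.
  objective : ℕ → (t : Tree) → (Vertex t → ℕ) → ℕ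
  objective s t h = total t λ v → s + pathTotal h v

  -- Only the root's own contribution is dropped; a lower bound on the LP value is all that is
  -- wanted.
  objective-node : ∀ {s k ts h} →
    sum (λ i → objective (s + h root) (ts i) (h ∘ child i)) ≤ objective s (node k ts) h
  objective-node {s} {k} {ts} {h} = ℕ.≤-trans
    (sum-mono λ i → total-mono (ts i) λ v → ℕ.≤-reflexive
      (trans (ℕ.+-assoc s (h root) _) (cong (s +_) (sym (pathTotal-child {ts = ts} h i v)))))
    (ℕ.m≤n+m _ _)

-- The instance

module _ where
  open import Data.Nat.Base using (_+_; _*_; _≤_; _<_)

  star : ℕ → Tree
  star m = node m λ _ → node 0 λ ()

  chain : ℕ → Tree → Tree
  chain zero    t = t
  chain (suc n) t = node 1 λ _ → chain n t

  hub : ∀ {m} → Vertex (star m) → ℕ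
  hub root        = 1
  hub (child _ _) = 0

  onChain : ∀ n {t} → (Vertex t → ℕ) → Vertex (chain n t) → ℕ
  onChain zero    h v           = h v
  onChain (suc n) h root        = 0
  onChain (suc n) h (child _ v) = onChain n h v

  total-star : ∀ m → total (star m) hub ≡ 1
  total-star m = cong suc (sum-zero {m} λ _ → refl)

  total-chain : ∀ n t h → total (chain n t) (onChain n h) ≡ total t h
  total-chain zero    t h = refl
  total-chain (suc n) t h = trans (ℕ.+-identityʳ _) (total-chain n t h)

  size-star : ∀ m → size (star m) ≡ suc m
  size-star m = cong suc (trans (sum-const m 1) (ℕ.*-identityʳ m))

  size-chain : ∀ n t → size (chain n t) ≡ n + size t
  size-chain zero    t = refl
  size-chain (suc n) t = cong suc (trans (ℕ.+-identityʳ _) (size-chain n t))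

  depth-star : ∀ {m} (v : Vertex (star m)) → depth v ≤ 1
  depth-star root           = z≤n
  depth-star (child _ root) = s≤s z≤n

  depth-chain : ∀ n {t d} → (∀ (v : Vertex t) → depth v ≤ d) → ∀ (v : Vertex (chain n t)) → depth v ≤ n + d
  depth-chain zero    ≤d v           = ≤d v
  depth-chain (suc n) ≤d root        = z≤n
  depth-chain (suc n) ≤d (child _ v) = s≤s (depth-chain n ≤d v)

  objective-chain : ∀ n {s t h} → objective s t h ≤ objective s (chain n t) (onChain n h)
  objective-chain zero    = ℕ.≤-refl
  objective-chain (suc n) {s} {t} {h} = begin
    objective s t h                                        ≤⟨ objective-chain n ⟩
    objective s (chain n t) (onChain n h)                  ≡⟨ cong (λ s → objective s (chain n t) (onChain n h)) (ℕ.+-identityʳ s) ⟨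
    objective (s + 0) (chain n t) (onChain n h)            ≡⟨ ℕ.+-identityʳ _ ⟨
    objective (s + 0) (chain n t) (onChain n h) + 0        ≤⟨ objective-node {s} {h = onChain (suc n) h} ⟩
    objective s (chain (suc n) t) (onChain (suc n) h)      ∎
    where open ℕ.≤-Reasoning

  objective-star : ∀ s m → m * (s + 1) ≤ objective s (star m) hub
  objective-star s m = begin
    m * (s + 1)                                                     ≡⟨ sum-const m (s + 1) ⟨
    sum {m} (λ _ → s + 1)
      ≤⟨ sum-mono {m} (λ _ → ℕ.≤-trans (ℕ.m≤m+n (s + 1) 0) (ℕ.m≤m+n (s + 1 + 0) 0)) ⟩
    sum {m} (λ i → objective (s + 1) (node 0 λ ()) (λ _ → 0))
      ≡⟨ sum-cong-≗ {m} (λ i → total-cong (node 0 λ ())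
           {λ v → s + 1 + pathTotal (λ _ → 0) v} {λ v → s + 1 + pathTotal (hub {m} ∘ child i) v} λ { root → refl }) ⟩
    sum {m} (λ i → objective (s + 1) (node 0 λ ()) (hub {m} ∘ child i)) ≤⟨ objective-node {s} {h = hub {m}} ⟩
    objective s (star m) hub                                        ∎
    where open ℕ.≤-Reasoning

  -- Layer weights as sums of indicator functions

  δ : ℕ → ℕ → ℕ
  δ m j = if m ≡ᵇ j then 1 else 0

  δ-≢ : ∀ {m j} → j < m → δ m j ≡ 0
  δ-≢ {suc m} {zero}  _         = refl
  δ-≢ {suc m} {suc j} (s≤s j<m) = δ-≢ j<m

  -- The indicator of c ≤ j < c + n.
  box : ℕ → ℕ → ℕ → ℕ
  box c zero    j = 0
  box c (suc n) j = δ c j + box (suc c) n j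

  sum-δ : ∀ c n j → sum {n} (λ i → δ (c + toℕ i) j) ≡ box c n j
  sum-δ c zero    j = refl
  sum-δ c (suc n) j = cong₂ _+_ (cong (λ m → δ m j) (ℕ.+-identityʳ c))
    (trans (sum-cong-≗ {n} λ i → cong (λ m → δ m j) (ℕ.+-suc c (toℕ i))) (sum-δ (suc c) n j))

  box-< : ∀ {c} n {j} → j < c → box c n j ≡ 0
  box-< zero    j<c = refl
  box-< (suc n) j<c = cong₂ _+_ (δ-≢ j<c) (box-< n (ℕ.m<n⇒m<1+n j<c))

  box≤1 : ∀ c n j → box c n j ≤ 1
  box≤1 c zero    j = z≤n
  box≤1 c (suc n) j with ℕ.<-cmp c j
  ... | tri< c<j _ _  = ℕ.≤-trans (ℕ.+-monoˡ-≤ _ (ℕ.≤-reflexive (δ-> c<j))) (box≤1 (suc c) n j)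
    where
      δ-> : ∀ {m j} → m < j → δ m j ≡ 0
      δ-> {zero}  {suc j} _         = refl
      δ-> {suc m} {suc j} (s≤s m<j) = δ-> m<j
  ... | tri≈ _ refl _ =
    ℕ.≤-trans (ℕ.≤-reflexive (trans (cong (δ c c +_) (box-< n ℕ.≤-refl)) (ℕ.+-identityʳ _))) (δ≤1 c c)
    where
      δ≤1 : ∀ m j → δ m j ≤ 1
      δ≤1 zero    zero    = ℕ.≤-refl
      δ≤1 zero    (suc j) = z≤n
      δ≤1 (suc m) zero    = z≤n
      δ≤1 (suc m) (suc j) = δ≤1 m j
  ... | tri> _ _ j<c  = ℕ.≤-trans (ℕ.≤-reflexive (box-< (suc n) j<c)) z≤n

  box-++ : ∀ c m n j → box c (m + n) j ≡ box c m j + box (c + m) n j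
  box-++ c zero    n j = cong (λ c → box c n j) (sym (ℕ.+-identityʳ c))
  box-++ c (suc m) n j =
    trans (cong (δ c j +_) (trans (box-++ (suc c) m n j) (cong (λ c′ → box (suc c) m j + box c′ n j) (sym (ℕ.+-suc c m)))))
    (sym (ℕ.+-assoc (δ c j) _ _))

  box-suc : ∀ c n j → box (suc c) n (suc j) ≡ box c n j
  box-suc c zero    j = refl
  box-suc c (suc n) j = cong (δ c j +_) (box-suc (suc c) n j)

  layer-zero : ∀ t {h} → (∀ v → h v ≡ 0) → ∀ j → layer t h j ≡ 0
  layer-zero (node k ts) h≡0 zero    = h≡0 root
  layer-zero (node k ts) h≡0 (suc j) = sum-zero λ i → layer-zero (ts i) (h≡0 ∘ child i) j

  layer-star : ∀ m j → layer (star m) hub j ≡ δ 0 j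
  layer-star m zero    = refl
  layer-star m (suc j) = sum-zero {m} λ _ → layer-zero (node 0 λ ()) (λ _ → refl) j

  shift : ℕ → (ℕ → ℕ) → ℕ → ℕ
  shift zero    f j       = f j
  shift (suc n) f zero    = 0
  shift (suc n) f (suc j) = shift n f j

  shift-cong : ∀ n {f g} → (∀ j → f j ≡ g j) → ∀ j → shift n f j ≡ shift n g j
  shift-cong zero    f≗g j       = f≗g j
  shift-cong (suc n) f≗g zero    = refl
  shift-cong (suc n) f≗g (suc j) = shift-cong n f≗g j

  shift-+ : ∀ n f g j → shift n (λ j → f j + g j) j ≡ shift n f j + shift n g j
  shift-+ zero    f g j       = refl
  shift-+ (suc n) f g zero    = refl
  shift-+ (suc n) f g (suc j) = shift-+ n f g j

  shift-δ : ∀ n m j → shift n (δ m) j ≡ δ (n + m) j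
  shift-δ zero    m j       = refl
  shift-δ (suc n) m zero    = refl
  shift-δ (suc n) m (suc j) = shift-δ n m j

  layer-chain : ∀ n {t h} j → layer (chain n t) (onChain n h) j ≡ shift n (layer t h) j
  layer-chain zero    j       = refl
  layer-chain (suc n) zero    = refl
  layer-chain (suc n) (suc j) = trans (ℕ.+-identityʳ _) (layer-chain n j)

  leg : ℕ → ℕ → Tree
  leg n m = chain n (star m)

  legHub : ∀ n {m} → Vertex (leg n m) → ℕ
  legHub n = onChain n hub

  layer-leg : ∀ n m j → layer (leg n m) (legHub n) j ≡ δ n j
  layer-leg n m j = begin
    layer (leg n m) (legHub n) j    ≡⟨ layer-chain n j ⟩
    shift n (layer (star m) hub) j  ≡⟨ shift-cong n (layer-star m) j ⟩
    shift n (δ 0) j                 ≡⟨ shift-δ n 0 j ⟩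
    δ (n + 0) j                     ≡⟨ cong (λ n → δ n j) (ℕ.+-identityʳ n) ⟩
    δ n j                           ∎
    where open ≡-Reasoning

  total-leg : ∀ n m → total (leg n m) (legHub n) ≡ 1
  total-leg n m = trans (total-chain n (star m) hub) (total-star m)

  size-leg : ∀ n m → size (leg n m) ≡ n + suc m
  size-leg n m = trans (size-chain n (star m)) (cong (n +_) (size-star m))

  depth-leg : ∀ n {m} (v : Vertex (leg n m)) → depth v ≤ n + 1
  depth-leg n = depth-chain n depth-star

  objective-leg : ∀ n s m → m * (s + 1) ≤ objective s (leg n m) (legHub n)
  objective-leg n s m = ℕ.≤-trans (objective-star s m) (objective-chain n)

  -- The tree and its half-integral solution; `W`, `b` and `K` count the leaves of a star

  module Instance (p′ q W b K : ℕ) where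

    p = suc p′

    -- A leg of length `n` hung below a vertex of depth `d` has its hub at depth `d + 1 + n`. In `A`
    -- the hubs are thus at `3 + 2p + j`; in `C₁`, whose root is one layer deeper, the legs are one
    -- shorter for the same layers.
    branchesA : Fin (suc q) → Tree
    branchesA zero    = star W
    branchesA (suc j) = leg (1 + (p + p) + toℕ j) K

    A B C₁ C : Tree
    A  = node (suc q) branchesA
    B  = node (p + p) λ i → leg (1 + toℕ i) b
    C₁ = node q λ j → leg (p + p + toℕ j) K
    C  = chain 1 C₁

    -- The two picks are `p′ + 1 = p` layers apart. As `i` runs below `p`, the upper picks of the
    -- `D i` fill the layers from 3 to `2 + p` and the lower ones the next `p` layers.
    D₁ : Tree
    D₁ = node 1 λ _ → leg p′ b

    D : ℕ → Tree
    D i = chain (2 + i) D₁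

    branches : Fin (3 + p) → Tree
    branches zero                = A
    branches (suc zero)          = B
    branches (suc (suc zero))    = C
    branches (suc (suc (suc i))) = D (toℕ i)

    tree : Tree
    tree = node (3 + p) branches

    -- Twice the fractional picks.
    hA : Vertex A → ℕ
    hA root              = 1
    hA (child zero v)    = hub v
    hA (child (suc j) v) = legHub (1 + (p + p) + toℕ j) v

    hB : Vertex B → ℕ
    hB root        = 1
    hB (child i v) = legHub (1 + toℕ i) v

    hC₁ : Vertex C₁ → ℕ
    hC₁ root        = 1
    hC₁ (child j v) = legHub (p + p + toℕ j) v

    hC : Vertex C → ℕ
    hC = onChain 1 hC₁

    hD₁ : Vertex D₁ → ℕ
    hD₁ root        = 1
    hD₁ (child _ v) = legHub p′ v

    hD : ∀ i → Vertex (D i) → ℕ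
    hD i = onChain (2 + i) hD₁

    h : Vertex tree → ℕ
    h root                              = 0
    h (child zero v)                    = hA v
    h (child (suc zero) v)              = hB v
    h (child (suc (suc zero)) v)        = hC v
    h (child (suc (suc (suc i))) v)     = hD (toℕ i) v

    -- Layers are counted from the root of a branch, so they are one less than in `tree`.
    late : ℕ → ℕ
    late = box (2 + (p + p)) q

    layer-legs : ∀ c n m j → sum {n} (λ i → layer (leg (c + toℕ i) m) (legHub (c + toℕ i)) j) ≡ box c n j
    layer-legs c n m j = trans (sum-cong-≗ {n} λ i → layer-leg (c + toℕ i) m j) (sum-δ c n j)

    layer-A : ∀ j → layer A hA j ≡ δ 0 j + δ 1 j + late j
    layer-A zero    = cong suc (sym (box-< q (s≤s z≤n)))
    layer-A (suc j) = trans
      (cong₂ _+_ (layer-star W j) (layer-legs (1 + (p + p)) q K j))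
      (cong (δ 0 j +_) (sym (box-suc (1 + (p + p)) q j)))

    layer-B : ∀ j → layer B hB j ≡ δ 0 j + box 2 (p + p) j
    layer-B zero    = cong suc (sym (box-< (p + p) (s≤s z≤n)))
    layer-B (suc j) = trans (layer-legs 1 (p + p) b j) (sym (box-suc 1 (p + p) j))

    layer-C : ∀ j → layer C hC j ≡ δ 1 j + late j
    layer-C zero          = sym (box-< q (s≤s z≤n))
    layer-C (suc zero)    = cong suc (sym (box-< q (s≤s (s≤s z≤n))))
    layer-C (suc (suc j)) = trans (ℕ.+-identityʳ _) (trans (layer-legs (p + p) q K j)
      (sym (trans (box-suc (1 + (p + p)) q (suc j)) (box-suc (p + p) q j))))

    layer-D₁ : ∀ j → layer D₁ hD₁ j ≡ δ 0 j + δ p j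
    layer-D₁ zero    = refl
    layer-D₁ (suc j) = trans (ℕ.+-identityʳ _) (layer-leg p′ b j)

    layer-D : ∀ i j → layer (D i) (hD i) j ≡ δ (2 + i) j + δ (2 + p + i) j
    layer-D i j = begin
      layer (D i) (hD i) j                     ≡⟨ layer-chain (2 + i) j ⟩
      shift (2 + i) (layer D₁ hD₁) j           ≡⟨ shift-cong (2 + i) layer-D₁ j ⟩
      shift (2 + i) (λ j → δ 0 j + δ p j) j    ≡⟨ shift-+ (2 + i) (δ 0) (δ p) j ⟩
      shift (2 + i) (δ 0) j + shift (2 + i) (δ p) j ≡⟨ cong₂ _+_ (shift-δ (2 + i) 0 j) (shift-δ (2 + i) p j) ⟩
      δ (2 + i + 0) j + δ (2 + i + p) j
        ≡⟨ cong₂ (λ m n → δ (2 + m) j + δ (2 + n) j) (ℕ.+-identityʳ i) (ℕ.+-comm i p) ⟩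
      δ (2 + i) j + δ (2 + p + i) j            ∎
      where open ≡-Reasoning

    -- The runs of upper and of lower picks are adjacent intervals of length `p`, joined by
    -- `box-++`.
    layer-Ds : ∀ j → sum {p} (λ i → layer (D (toℕ i)) (hD (toℕ i)) j) ≡ box 2 (p + p) j
    layer-Ds j = begin
      sum {p} (λ i → layer (D (toℕ i)) (hD (toℕ i)) j)
        ≡⟨ sum-cong-≗ {p} (λ i → layer-D (toℕ i) j) ⟩
      sum {p} (λ i → δ (2 + toℕ i) j + δ (2 + p + toℕ i) j)
        ≡⟨ ∑-distrib-+ {p} (λ i → δ (2 + toℕ i) j) (λ i → δ (2 + p + toℕ i) j) ⟩
      sum {p} (λ i → δ (2 + toℕ i) j) + sum {p} (λ i → δ (2 + p + toℕ i) j)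
        ≡⟨ cong₂ _+_ (sum-δ 2 p j) (sum-δ (2 + p) p j) ⟩
      box 2 p j + box (2 + p) p j
        ≡⟨ box-++ 2 p p j ⟨
      box 2 (p + p) j ∎
      where open ≡-Reasoning

    stream : ℕ → ℕ
    stream = box 0 (2 + (p + p + q))

    stream≡ : ∀ j → stream j ≡ δ 0 j + (δ 1 j + (box 2 (p + p) j + late j))
    stream≡ j = cong (λ n → δ 0 j + (δ 1 j + n)) (box-++ 2 (p + p) q j)

    -- Layer by layer, the fractional picks form two sequences with one half-pick each.
    layer-tree : ∀ j → layer tree h (suc j) ≡ stream j + stream j
    layer-tree j = begin
      layer A hA j + (layer B hB j + (layer C hC j + sum {p} (λ i → layer (D (toℕ i)) (hD (toℕ i)) j)))
        ≡⟨ cong₂ _+_ (layer-A j) (cong₂ _+_ (layer-B j) (cong₂ _+_ (layer-C j) (layer-Ds j))) ⟩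
      δ 0 j + δ 1 j + late j + (δ 0 j + box 2 (p + p) j + (δ 1 j + late j + box 2 (p + p) j))
        ≡⟨ solve 4 (λ x y z w → x :+ y :+ w :+ (x :+ z :+ (y :+ w :+ z)) := (x :+ (y :+ (z :+ w))) :+ (x :+ (y :+ (z :+ w))))
             refl (δ 0 j) (δ 1 j) (box 2 (p + p) j) (late j) ⟩
      (δ 0 j + (δ 1 j + (box 2 (p + p) j + late j))) + (δ 0 j + (δ 1 j + (box 2 (p + p) j + late j)))
        ≡⟨ cong₂ _+_ (stream≡ j) (stream≡ j) ⟨
      stream j + stream j ∎
      where
        open ≡-Reasoning
        open ℕ-Solver

    stream≤1 : ∀ j → stream j ≤ 1
    stream≤1 = box≤1 0 (2 + (p + p + q))

    -- The layers used by `A` are among those of `stream`, and so they are each used at most once;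
    -- likewise for `B` and `C`.
    layer-A≤1 : ∀ j → layer A hA j ≤ 1
    layer-A≤1 j = begin
      layer A hA j                                               ≡⟨ layer-A j ⟩
      δ 0 j + δ 1 j + late j                                     ≡⟨ ℕ.+-assoc (δ 0 j) (δ 1 j) (late j) ⟩
      δ 0 j + (δ 1 j + late j)
        ≤⟨ ℕ.+-monoʳ-≤ (δ 0 j) (ℕ.+-monoʳ-≤ (δ 1 j) (ℕ.m≤n+m (late j) (box 2 (p + p) j))) ⟩
      δ 0 j + (δ 1 j + (box 2 (p + p) j + late j))               ≡⟨ stream≡ j ⟨
      stream j                                                   ≤⟨ stream≤1 j ⟩
      1                                                          ∎
      where open ℕ.≤-Reasoning

    layer-B≤1 : ∀ j → layer B hB j ≤ 1
    layer-B≤1 j = begin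
      layer B hB j                                               ≡⟨ layer-B j ⟩
      δ 0 j + box 2 (p + p) j
        ≤⟨ ℕ.+-monoʳ-≤ (δ 0 j) (ℕ.≤-trans (ℕ.m≤m+n (box 2 (p + p) j) (late j)) (ℕ.m≤n+m _ (δ 1 j))) ⟩
      δ 0 j + (δ 1 j + (box 2 (p + p) j + late j))               ≡⟨ stream≡ j ⟨
      stream j                                                   ≤⟨ stream≤1 j ⟩
      1                                                          ∎
      where open ℕ.≤-Reasoning

    layer-C≤1 : ∀ j → layer C hC j ≤ 1
    layer-C≤1 j = begin
      layer C hC j                                               ≡⟨ layer-C j ⟩
      δ 1 j + late j
        ≤⟨ ℕ.≤-trans (ℕ.+-monoʳ-≤ (δ 1 j) (ℕ.m≤n+m (late j) (box 2 (p + p) j))) (ℕ.m≤n+m _ (δ 0 j)) ⟩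
      δ 0 j + (δ 1 j + (box 2 (p + p) j + late j))               ≡⟨ stream≡ j ⟨
      stream j                                                   ≤⟨ stream≤1 j ⟩
      1                                                          ∎
      where open ℕ.≤-Reasoning

    -- At the source a layer holds two half-picks. At the roots of `A`, `B` and `C₁` one half-pick
    -- is spent and each layer below adds at most one; the root of `C` carries none. A leg adds one
    -- half-pick to the one above it, and a `D i` has two in all.
    hartke-tree : HartkeBounded 0 tree h
    hartke-tree = hartkeBounded-node
      (λ j → ℕ.≤-trans (ℕ.≤-reflexive (layer-tree j)) (ℕ.+-mono-≤ (stream≤1 j) (stream≤1 j)))
      λ { zero                → hartkeBounded-node (s≤s ∘ layer-A≤1 ∘ suc) λ
            { zero    → hartkeBounded-total (ℕ.≤-reflexive (cong suc (total-star W)))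
            ; (suc j) → hartkeBounded-total (ℕ.≤-reflexive (cong suc (total-leg (1 + (p + p) + toℕ j) K))) }
        ; (suc zero)          → hartkeBounded-node (s≤s ∘ layer-B≤1 ∘ suc) λ
            i → hartkeBounded-total (ℕ.≤-reflexive (cong suc (total-leg (1 + toℕ i) b)))
        ; (suc (suc zero))    → hartkeBounded-node (ℕ.m≤n⇒m≤1+n ∘ layer-C≤1 ∘ suc) λ
            _ → hartkeBounded-node
              (λ j → s≤s (ℕ.≤-trans (ℕ.≤-reflexive (sym (ℕ.+-identityʳ _))) (layer-C≤1 (2 + j))))
              λ j → hartkeBounded-total (ℕ.≤-reflexive (cong suc (total-leg (p + p + toℕ j) K)))
        ; (suc (suc (suc i))) → hartkeBounded-total (ℕ.≤-reflexive (trans (total-chain (2 + toℕ i) D₁ hD₁)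
            (cong suc (trans (ℕ.+-identityʳ _) (total-leg p′ b))))) }

    -- Every star leaf is saved completely.
    objective-tree : 2 * (W + (p + p) * b + p * b + (q * K + q * K)) ≤ objective 0 tree h
    objective-tree = begin
      2 * (W + (p + p) * b + p * b + (q * K + q * K))
        ≡⟨ solve 5 (λ w p b q k → con 2 :* (w :+ (p :+ p) :* b :+ p :* b :+ (q :* k :+ q :* k))
             := (w :* con 2 :+ q :* (k :* con 2)) :+ ((p :+ p) :* (b :* con 2) :+ (q :* (k :* con 2) :+ p :* (b :* con 2))))
             refl W p b q K ⟩
      (W * 2 + q * (K * 2)) + ((p + p) * (b * 2) + (q * (K * 2) + p * (b * 2)))
        ≤⟨ ℕ.+-mono-≤ objective-A (ℕ.+-mono-≤ objective-B (ℕ.+-mono-≤ objective-C objective-Ds)) ⟩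
      objective 0 A hA + (objective 0 B hB + (objective 0 C hC + sum {p} (λ i → objective 0 (D (toℕ i)) (hD (toℕ i)))))
        ≤⟨ objective-node {0} {h = h} ⟩
      objective 0 tree h ∎
      where
        open ℕ.≤-Reasoning
        open ℕ-Solver

        legs : ∀ c n m → n * (m * 2) ≤ sum {n} (λ i → objective 1 (leg (c + toℕ i) m) (legHub (c + toℕ i)))
        legs c n m = ℕ.≤-trans (ℕ.≤-reflexive (sym (sum-const n (m * 2)))) (sum-mono {n} λ i → objective-leg (c + toℕ i) 1 m)

        objective-A : W * 2 + q * (K * 2) ≤ objective 0 A hA
        objective-A =
          ℕ.≤-trans (ℕ.+-mono-≤ (objective-star 1 W) (legs (1 + (p + p)) q K)) (objective-node {0} {h = hA})

        objective-B : (p + p) * (b * 2) ≤ objective 0 B hB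
        objective-B = ℕ.≤-trans (legs 1 (p + p) b) (objective-node {0} {h = hB})

        objective-C : q * (K * 2) ≤ objective 0 C hC
        objective-C =
          ℕ.≤-trans (legs (p + p) q K) (ℕ.≤-trans (objective-node {0} {h = hC₁}) (objective-chain 1 {0} {C₁} {hC₁}))

        objective-D : ∀ i → b * 2 ≤ objective 0 (D i) (hD i)
        objective-D i = ℕ.≤-trans (objective-leg p′ 1 b) (ℕ.≤-trans (ℕ.m≤m+n _ 0)
          (ℕ.≤-trans (objective-node {0} {h = hD₁}) (objective-chain (2 + i) {0} {D₁} {hD₁})))

        objective-Ds : p * (b * 2) ≤ sum {p} (λ i → objective 0 (D (toℕ i)) (hD (toℕ i)))
        objective-Ds =
          ℕ.≤-trans (ℕ.≤-reflexive (sym (sum-const p (b * 2)))) (sum-mono {p} λ i → objective-D (toℕ i))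

    -- No vertex lies deeper than this.
    N : ℕ
    N = 3 + (p + p) + q

    -- The depth bound `N` also covers the chain and the star's centre, which gives one common price
    -- for every pick on a leg.
    leg≤ : ∀ n m → n < N → size (leg n m) ≤ N + m
    leg≤ n m n<N = ℕ.≤-trans (ℕ.≤-reflexive (trans (size-leg n m) (ℕ.+-suc n m))) (ℕ.+-monoˡ-≤ m n<N)

    size-leg-A≤ : ∀ (j : Fin q) → size (leg (1 + (p + p) + toℕ j) K) ≤ N + K
    size-leg-A≤ j =
      leg≤ (1 + (p + p) + toℕ j) K (ℕ.+-mono-≤-< (ℕ.+-monoˡ-≤ (p + p) {1} {3} (s≤s z≤n)) (Fin.toℕ<n j))

    size-leg-B≤ : ∀ (i : Fin (p + p)) → size (leg (1 + toℕ i) b) ≤ N + b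
    size-leg-B≤ i =
      leg≤ (1 + toℕ i) b (ℕ.<-≤-trans (s≤s (s≤s (Fin.toℕ≤n i))) (ℕ.≤-trans (ℕ.+-monoˡ-≤ (p + p) (ℕ.n≤1+n 2)) (ℕ.m≤m+n _ q)))

    size-leg-C≤ : ∀ (j : Fin q) → size (leg (p + p + toℕ j) K) ≤ N + K
    size-leg-C≤ j = leg≤ (p + p + toℕ j) K (ℕ.+-mono-≤-< (ℕ.m≤n+m (p + p) 3) (Fin.toℕ<n j))

    size-D≤ : ∀ (i : Fin p) → size (D (toℕ i)) ≤ N + b
    size-D≤ i = begin
      size (D (toℕ i))                  ≡⟨ size-chain (2 + toℕ i) D₁ ⟩
      2 + toℕ i + suc (size (leg p′ b) + 0)
        ≡⟨ cong (λ n → 2 + toℕ i + suc n) (trans (ℕ.+-identityʳ _) (size-leg p′ b)) ⟩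
      2 + toℕ i + suc (p′ + suc b)
        ≡⟨ solve 3 (λ i p b → con 2 :+ i :+ (con 1 :+ (p :+ (con 1 :+ b))) := con 3 :+ i :+ (con 1 :+ p) :+ b) refl (toℕ i) p′ b ⟩
      3 + toℕ i + p + b
        ≤⟨ ℕ.+-monoˡ-≤ b (ℕ.≤-trans (ℕ.+-monoˡ-≤ p (ℕ.+-monoʳ-≤ 3 (Fin.toℕ≤n i))) (ℕ.m≤m+n _ q)) ⟩
      N + b                             ∎
      where
        open ℕ.≤-Reasoning
        open ℕ-Solver

    sum-≤-const : ∀ n {f : Fin n → ℕ} c → (∀ i → f i ≤ c) → sum f ≤ n * c
    sum-≤-const n c f≤c = ℕ.≤-trans (sum-mono {n} f≤c) (ℕ.≤-reflexive (sum-const n c))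

    -- The 6 counts the source, the roots of `A`, `B`, `C` and `C₁`, and the centre of the star of
    -- `W` leaves.
    size-tree≤ : size tree ≤ 6 + W + (p + p + p) * (N + b) + (q + q) * (N + K)
    size-tree≤ = begin
      1 + (size A + (size B + (size C + sum {p} (λ i → size (D (toℕ i))))))
        ≤⟨ s≤s (ℕ.+-mono-≤
             (s≤s (ℕ.+-mono-≤ (ℕ.≤-reflexive (size-star W)) (sum-≤-const q (N + K) size-leg-A≤)))
             (ℕ.+-mono-≤ (s≤s (sum-≤-const (p + p) (N + b) size-leg-B≤))
               (ℕ.+-mono-≤ (s≤s (ℕ.+-monoˡ-≤ 0 (s≤s (sum-≤-const q (N + K) size-leg-C≤))))
                 (sum-≤-const p (N + b) size-D≤)))) ⟩
      1 + ((1 + ((1 + W) + q * (N + K))) + ((1 + (p + p) * (N + b)) + ((1 + ((1 + q * (N + K)) + 0)) + p * (N + b))))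
        ≡⟨ solve 5 (λ w p b q k → con 1 :+ ((con 1 :+ ((con 1 :+ w) :+ q :* k)) :+
           ((con 1 :+ (p :+ p) :* b) :+ ((con 1 :+ ((con 1 :+ q :* k) :+ con 0)) :+ p :* b)))
             := con 6 :+ w :+ (p :+ p :+ p) :* b :+ (q :+ q) :* k) refl W p (N + b) q (N + K) ⟩
      6 + W + (p + p + p) * (N + b) + (q + q) * (N + K) ∎
      where
        open ℕ.≤-Reasoning
        open ℕ-Solver

    -- Upper bounds for strategies, one module for each case

    pattern inA v   = child zero v
    pattern inB v   = child (suc zero) v
    pattern inC v   = child (suc (suc zero)) v
    pattern inD i v = child (suc (suc (suc i))) v

    subtotal-zero : ∀ t {g} → (∀ v → g v ≡ 0) → ∀ v → subtotal t g v ≤ 0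
    subtotal-zero t g≡0 v = ℕ.≤-trans (subtotal≤total t _ v) (ℕ.≤-reflexive (total-zero t g≡0))

    sum-≥-const : ∀ n {f : Fin n → ℕ} c → (∀ i → c ≤ f i) → n * c ≤ sum f
    sum-≥-const n c c≤f = ℕ.≤-trans (ℕ.≤-reflexive (sym (sum-const n c))) (sum-mono {n} c≤f)

    ≤size-leg : ∀ n m → m ≤ size (leg n m)
    ≤size-leg n m = ℕ.≤-trans (ℕ.≤-trans (ℕ.n≤1+n m) (ℕ.m≤n+m (suc m) n)) (ℕ.≤-reflexive (sym (size-leg n m)))

    ≤size-D : ∀ i → b ≤ size (D i)
    ≤size-D i = ℕ.≤-trans (≤size-leg p′ b) (ℕ.≤-trans (ℕ.≤-trans (ℕ.m≤m+n _ 0) (ℕ.n≤1+n _))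
      (ℕ.≤-trans (ℕ.m≤n+m (size D₁) (2 + i)) (ℕ.≤-reflexive (sym (size-chain (2 + i) D₁)))))

    rootB topC : Vertex tree
    rootB = inB root
    topC  = inC (child zero root)

    -- Case without `rootB`: there are `3p` stars of `b` leaves and only `2p + 3` picks early
    -- enough, each good for one star. About `(p - 3) * b` is lost.
    module BD where
      g : Vertex tree → ℕ
      g root              = 0
      g (inA _)           = 0
      g (inB root)        = 0
      g (inB (child _ _)) = 1
      g (inC _)           = 0
      g (inD _ _)         = 1

      g≤1 : ∀ u → g u ≤ 1
      g≤1 root              = z≤n
      g≤1 (inA _)           = z≤n
      g≤1 (inB root)        = z≤n
      g≤1 (inB (child _ _)) = ℕ.≤-refl
      g≤1 (inC _)           = z≤n
      g≤1 (inD _ _)         = ℕ.≤-refl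

      -- The last hubs of this phase are in layer `2 + 2p`, their leaves one layer below.
      H : ℕ
      H = 3 + (p + p)

      shallow : ∀ u → H < depth u → g u ≡ 0
      shallow root              _  = refl
      shallow (inA _)           _  = refl
      shallow (inB root)        _  = refl
      shallow (inB (child i v)) H< = contradiction (begin
        2 + depth v            ≤⟨ ℕ.+-monoʳ-≤ 2 (depth-leg (1 + toℕ i) v) ⟩
        2 + (1 + toℕ i + 1)    ≡⟨ cong (2 +_) (ℕ.+-comm (1 + toℕ i) 1) ⟩
        3 + suc (toℕ i)        ≤⟨ ℕ.+-monoʳ-≤ 3 (Fin.toℕ<n i) ⟩
        H                      ∎) (ℕ.<⇒≱ H<)
        where open ℕ.≤-Reasoning
      shallow (inC _)           _  = refl
      shallow (inD i v)         H< = contradiction (begin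
        1 + depth v                       ≤⟨ s≤s (depth-chain (2 + toℕ i) depth-D₁ v) ⟩
        1 + (2 + toℕ i + (1 + (p′ + 1)))
          ≡⟨ solve 2 (λ i p → con 1 :+ (con 2 :+ i :+ (con 1 :+ (p :+ con 1))) := con 3 :+ ((con 1 :+ i) :+ (con 1 :+ p))) refl (toℕ i) p′ ⟩
        3 + (suc (toℕ i) + p)             ≤⟨ ℕ.+-monoʳ-≤ 3 (ℕ.+-monoˡ-≤ p (Fin.toℕ<n i)) ⟩
        H                                 ∎) (ℕ.<⇒≱ H<)
        where
          open ℕ.≤-Reasoning
          open ℕ-Solver
          depth-D₁ : ∀ (v : Vertex D₁) → depth v ≤ 1 + (p′ + 1)
          depth-D₁ root        = z≤n
          depth-D₁ (child _ v) = s≤s (depth-leg p′ v)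

      total-g : (p + p + p) * b ≤ total tree g
      total-g = begin
        (p + p + p) * b                       ≡⟨ ℕ.*-distribʳ-+ b (p + p) p ⟩
        (p + p) * b + p * b
          ≤⟨ ℕ.+-mono-≤ (sum-≥-const (p + p) b λ i → ≤size-leg (1 + toℕ i) b) (sum-≥-const p b (≤size-D ∘ toℕ)) ⟩
        sum {p + p} (λ i → size (leg (1 + toℕ i) b)) + sum {p} (λ i → size (D (toℕ i)))
          ≤⟨ ℕ.≤-trans (ℕ.+-monoʳ-≤ (sum {p + p} λ i → size (leg (1 + toℕ i) b)) (ℕ.m≤n+m _ (total C λ _ → 0)))
             (ℕ.m≤n+m _ (total A λ _ → 0)) ⟩
        total tree g                          ∎
        where open ℕ.≤-Reasoning

      -- Apart from the source and `rootB`, no vertex has marked vertices of two different legs or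
      -- branches below it.
      subtotal-g : ∀ v → 1 ≤ depth v → v ≢ rootB → subtotal tree g v ≤ N + b
      subtotal-g (inA v)           _ _  = ℕ.≤-trans (subtotal-zero A (λ _ → refl) v) z≤n
      subtotal-g (inB root)        _ ≢B = contradiction refl ≢B
      subtotal-g (inB (child i v)) _ _  =
        ℕ.≤-trans (subtotal≤total (leg (1 + toℕ i) b) (λ _ → 1) v) (size-leg-B≤ i)
      subtotal-g (inC v)           _ _  = ℕ.≤-trans (subtotal-zero C (λ _ → refl) v) z≤n
      subtotal-g (inD i v)         _ _  = ℕ.≤-trans (subtotal≤total (D (toℕ i)) (λ _ → 1) v) (size-D≤ i)

      savedCount≤ : ∀ σ → σ 0 ≢ rootB → savedCount σ + (p + p + p) * b ≤ size tree + H * (N + b)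
      savedCount≤ σ σ0≢ = ℕ.≤-trans (ℕ.+-monoʳ-≤ (savedCount σ) total-g)
        (savedCount-bound σ g H shallow g≤1 (N + b) λ k k< → subtotal-g (σ k) (ℕ.≤-trans (s≤s z≤n) k<)
          -- `rootB` has depth 1, so a pick of it that counts is the first one.
          λ σk≡ → σ0≢ (subst (λ k → σ k ≡ rootB) (ℕ.n<1⇒n≡0 (subst (λ v → k < depth v) σk≡ k<)) σk≡))

    -- Case of `rootB` without `topC`: there are `2q` stars of `K` leaves and `N = q + 2p + 3`
    -- picks, each good for one star. About `(q - 2p - 3) * K` is lost.
    module AC where
      g : Vertex tree → ℕ
      g root                               = 0
      g (inA root)                         = 0
      g (inA (child zero _))               = 0
      g (inA (child (suc _) _))            = 1
      g (inB _)                            = 0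
      g (inC root)                         = 0
      g (inC (child _ root))               = 0
      g (inC (child _ (child _ _)))        = 1
      g (inD _ _)                          = 0

      g≤1 : ∀ u → g u ≤ 1
      g≤1 root                             = z≤n
      g≤1 (inA root)                       = z≤n
      g≤1 (inA (child zero _))             = z≤n
      g≤1 (inA (child (suc _) _))          = ℕ.≤-refl
      g≤1 (inB _)                          = z≤n
      g≤1 (inC root)                       = z≤n
      g≤1 (inC (child _ root))             = z≤n
      g≤1 (inC (child _ (child _ _)))      = ℕ.≤-refl
      g≤1 (inD _ _)                        = z≤n

      shallow : ∀ u → N < depth u → g u ≡ 0
      shallow root                        _  = refl
      shallow (inA root)                  _  = refl
      shallow (inA (child zero _))        _  = refl
      shallow (inA (child (suc j) v))     N< = contradiction (begin
        2 + depth v                      ≤⟨ ℕ.+-monoʳ-≤ 2 (depth-leg (1 + (p + p) + toℕ j) v) ⟩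
        2 + (1 + (p + p) + toℕ j + 1)
          ≡⟨ solve 2 (λ p j → con 2 :+ (con 1 :+ (p :+ p) :+ j :+ con 1) := con 3 :+ (p :+ p) :+ (con 1 :+ j)) refl p (toℕ j) ⟩
        3 + (p + p) + suc (toℕ j)        ≤⟨ ℕ.+-monoʳ-≤ (3 + (p + p)) (Fin.toℕ<n j) ⟩
        N                                ∎) (ℕ.<⇒≱ N<)
        where
          open ℕ.≤-Reasoning
          open ℕ-Solver
      shallow (inB _)                     _  = refl
      shallow (inC root)                  _  = refl
      shallow (inC (child _ root))        _  = refl
      shallow (inC (child _ (child j v))) N< = contradiction (begin
        3 + depth v                      ≤⟨ ℕ.+-monoʳ-≤ 3 (depth-leg (p + p + toℕ j) v) ⟩
        3 + (p + p + toℕ j + 1)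
          ≡⟨ solve 2 (λ p j → con 3 :+ (p :+ p :+ j :+ con 1) := con 3 :+ (p :+ p) :+ (con 1 :+ j)) refl p (toℕ j) ⟩
        3 + (p + p) + suc (toℕ j)        ≤⟨ ℕ.+-monoʳ-≤ (3 + (p + p)) (Fin.toℕ<n j) ⟩
        N                                ∎) (ℕ.<⇒≱ N<)
        where
          open ℕ.≤-Reasoning
          open ℕ-Solver
      shallow (inD _ _)                   _  = refl

      total-g : (q + q) * K ≤ total tree g
      total-g = begin
        (q + q) * K      ≡⟨ ℕ.*-distribʳ-+ K q q ⟩
        q * K + q * K    ≤⟨ ℕ.+-mono-≤
          (ℕ.≤-trans (sum-≥-const q K λ j → ≤size-leg (1 + (p + p) + toℕ j) K) (ℕ.m≤n+m _ (total (star W) λ _ → 0)))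
          (ℕ.≤-trans (sum-≥-const q K λ j → ≤size-leg (p + p + toℕ j) K)
            (ℕ.≤-trans (ℕ.m≤m+n _ 0) (ℕ.≤-trans (ℕ.m≤m+n _ (sum {p} λ i → total (D (toℕ i)) λ _ → 0)) (ℕ.m≤n+m _ (total B λ _ → 0))))) ⟩
        total tree g     ∎
        where open ℕ.≤-Reasoning

      subtotal-g : ∀ v → 1 ≤ depth v → v ≢ inA root → v ≢ inC root → v ≢ topC → subtotal tree g v ≤ N + K
      subtotal-g (inA root)                  _ ≢A _  _  = contradiction refl ≢A
      subtotal-g (inA (child zero v))        _ _  _  _  = ℕ.≤-trans (subtotal-zero (star W) (λ _ → refl) v) z≤n
      subtotal-g (inA (child (suc j) v))     _ _  _  _  =
        ℕ.≤-trans (subtotal≤total (leg (1 + (p + p) + toℕ j) K) (λ _ → 1) v) (size-leg-A≤ j)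
      subtotal-g (inB v)                     _ _  _  _  = ℕ.≤-trans (subtotal-zero B (λ _ → refl) v) z≤n
      subtotal-g (inC root)                  _ _  ≢C _  = contradiction refl ≢C
      subtotal-g (inC (child zero root))     _ _  _  ≢c = contradiction refl ≢c
      subtotal-g (inC (child zero (child j v))) _ _ _ _ =
        ℕ.≤-trans (subtotal≤total (leg (p + p + toℕ j) K) (λ _ → 1) v) (size-leg-C≤ j)
      subtotal-g (inD i v)                   _ _  _  _  =
        ℕ.≤-trans (subtotal-zero (D (toℕ i)) (λ _ → refl) v) z≤n

      savedCount≤ : ∀ σ → σ 0 ≡ rootB → σ 1 ≢ topC → savedCount σ + (q + q) * K ≤ size tree + N * (N + K)
      savedCount≤ σ σ0≡ σ1≢ = ℕ.≤-trans (ℕ.+-monoʳ-≤ (savedCount σ) total-g)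
        (savedCount-bound σ g N shallow g≤1 (N + K) λ k k< → subtotal-g (σ k) (ℕ.≤-trans (s≤s z≤n) k<)
          (λ σk≡ → contradiction (trans (sym (first k< σk≡ ℕ.≤-refl)) σ0≡) λ ())
          (λ σk≡ → contradiction (trans (sym (first k< σk≡ ℕ.≤-refl)) σ0≡) λ ())
          (not-topC k k<))
        where
          -- The roots of `A` and `C` count only at time 1, and that pick went to `rootB`.
          first : ∀ {k v} → k < depth (σ k) → σ k ≡ v → depth v ≤ 1 → σ 0 ≡ v
          first {zero}  _  σk≡ _   = σk≡
          first {suc k} k< σk≡ v≤1 =
            contradiction (ℕ.≤-trans (subst (λ v → suc k < depth v) σk≡ k<) v≤1) λ { (s≤s ()) }

          -- At depth 2 it counts only at times 1 and 2, and neither pick is `topC`.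
          not-topC : ∀ k → k < depth (σ k) → σ k ≢ topC
          not-topC zero          _  σk≡ = contradiction (trans (sym σk≡) σ0≡) λ ()
          not-topC (suc zero)    _  σk≡ = σ1≢ σk≡
          not-topC (suc (suc k)) k< σk≡ =
            contradiction (subst (λ v → suc (suc k) < depth v) σk≡ k<) λ { (s≤s (s≤s ())) }

    -- Case of both: the first two picks lie outside `A`, and from time 3 on only single leaves of
    -- the star in layer 2 can be saved.
    module A₁ where
      g : Vertex tree → ℕ
      g root                    = 0
      g (inA root)              = 0
      g (inA (child zero _))    = 1
      g (inA (child (suc _) _)) = 0
      g (child (suc _) _)       = 0

      g≤1 : ∀ u → g u ≤ 1
      g≤1 root                    = z≤n
      g≤1 (inA root)              = z≤n
      g≤1 (inA (child zero _))    = ℕ.≤-refl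
      g≤1 (inA (child (suc _) _)) = z≤n
      g≤1 (child (suc _) _)       = z≤n

      shallow : ∀ u → 3 < depth u → g u ≡ 0
      shallow root                    _  = refl
      shallow (inA root)              _  = refl
      shallow (inA (child zero v))    3< = contradiction (ℕ.+-monoʳ-≤ 2 (depth-star v)) (ℕ.<⇒≱ 3<)
      shallow (inA (child (suc _) _)) _  = refl
      shallow (child (suc _) _)       _  = refl

      total-g : W ≤ total tree g
      total-g = ℕ.≤-trans (ℕ.n≤1+n W) (ℕ.≤-trans (ℕ.≤-reflexive (sym (size-star W)))
        (ℕ.≤-trans (ℕ.m≤m+n (size (star W)) _) (ℕ.m≤m+n _ (sum {2 + p} λ i → total (branches (suc i)) λ _ → 0))))

      subtotal-g : ∀ v → 3 ≤ depth v → subtotal tree g v ≤ 1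
      subtotal-g (inA (child zero (child _ root))) _ = ℕ.≤-refl
      subtotal-g (inA (child zero root))    (s≤s (s≤s ()))
      subtotal-g (inA root)                 (s≤s ())
      subtotal-g (inA (child (suc j) v))    _ =
        ℕ.≤-trans (subtotal-zero (leg (1 + (p + p) + toℕ j) K) (λ _ → refl) v) z≤n
      subtotal-g (child (suc i) v)          _ = ℕ.≤-trans (subtotal-zero (branches (suc i)) (λ _ → refl) v) z≤n

      savedCount≤ : ∀ σ → σ 0 ≡ rootB → σ 1 ≡ topC → savedCount σ + W ≤ size tree + 3 * 1
      savedCount≤ σ σ0≡ σ1≡ = ℕ.≤-trans (ℕ.+-monoʳ-≤ (savedCount σ) total-g)
        (savedCount-bound σ g 3 shallow g≤1 1 λ where
          zero          _  → subst (λ v → subtotal tree g v ≤ 1) (sym σ0≡) (ℕ.≤-trans (subtotal-zero B (λ _ → refl) root) z≤n)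
          (suc zero)    _  → subst (λ v → subtotal tree g v ≤ 1) (sym σ1≡) (ℕ.≤-trans (subtotal-zero C (λ _ → refl) (child zero root)) z≤n)
          (suc (suc k)) k< → subtotal-g (σ (suc (suc k))) (ℕ.≤-trans (s≤s (s≤s (s≤s z≤n))) k<))

-- The integrality gap

open import Data.Integer.Base using (+_)

toℚᵘ-fromℕ : ∀ n → toℚᵘ (fromℕ n) ℚᵘ.≃ mkℚᵘ (+ n) 0
toℚᵘ-fromℕ n = ℚ.toℚᵘ-fromℚᵘ (mkℚᵘ (+ n) 0)

fromℕ-+ : ∀ m n → fromℕ (m ℕ.+ n) ≡ fromℕ m ℚ.+ fromℕ n
fromℕ-+ m n = ℚ.toℚᵘ-injective (begin-equality
  toℚᵘ (fromℕ (m ℕ.+ n))                     ≃⟨ toℚᵘ-fromℕ (m ℕ.+ n) ⟩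
  mkℚᵘ (+ (m ℕ.+ n)) 0
    ≃⟨ *≡* (cong (ℤ._* (+ 1)) (cong₂ ℤ._+_ (sym (ℤ.*-identityʳ (+ m))) (sym (ℤ.*-identityʳ (+ n))))) ⟩
  mkℚᵘ (+ m) 0 ℚᵘ.+ mkℚᵘ (+ n) 0              ≃⟨ ℚᵘ.+-cong (toℚᵘ-fromℕ m) (toℚᵘ-fromℕ n) ⟨
  toℚᵘ (fromℕ m) ℚᵘ.+ toℚᵘ (fromℕ n)         ≃⟨ ℚ.toℚᵘ-homo-+ (fromℕ m) (fromℕ n) ⟨
  toℚᵘ (fromℕ m ℚ.+ fromℕ n)                  ∎)
  where open ℚᵘ.≤-Reasoning

fromℕ-* : ∀ m n → fromℕ (m ℕ.* n) ≡ fromℕ m ℚ.* fromℕ n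
fromℕ-* m n = ℚ.toℚᵘ-injective (begin-equality
  toℚᵘ (fromℕ (m ℕ.* n))                     ≃⟨ toℚᵘ-fromℕ (m ℕ.* n) ⟩
  mkℚᵘ (+ (m ℕ.* n)) 0                        ≃⟨ *≡* (cong (ℤ._* (+ 1)) (ℤ.pos-* m n)) ⟩
  mkℚᵘ (+ m) 0 ℚᵘ.* mkℚᵘ (+ n) 0              ≃⟨ ℚᵘ.*-cong (toℚᵘ-fromℕ m) (toℚᵘ-fromℕ n) ⟨
  toℚᵘ (fromℕ m) ℚᵘ.* toℚᵘ (fromℕ n)         ≃⟨ ℚ.toℚᵘ-homo-* (fromℕ m) (fromℕ n) ⟨
  toℚᵘ (fromℕ m ℚ.* fromℕ n)                  ∎)
  where open ℚᵘ.≤-Reasoning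

fromℕ-nonNegative : ∀ n → ℚ.NonNegative (fromℕ n)
fromℕ-nonNegative n = ℚ.normalize-nonNeg n 1

fromℕ-mono : ∀ {m n} → m ℕ.≤ n → fromℕ m ℚ.≤ fromℕ n
fromℕ-mono {m} m≤n with k , refl ← ℕ.m≤n⇒∃[o]m+o≡n m≤n = begin
  fromℕ m                ≡⟨ ℚ.+-identityʳ (fromℕ m) ⟨
  fromℕ m ℚ.+ 0ℚ         ≤⟨ ℚ.+-monoʳ-≤ (fromℕ m) (ℚ.nonNegative⁻¹ (fromℕ k) {{fromℕ-nonNegative k}}) ⟩
  fromℕ m ℚ.+ fromℕ k    ≡⟨ fromℕ-+ m k ⟨
  fromℕ (m ℕ.+ k)        ∎
  where open ℚ.≤-Reasoning

half : ℕ → ℚ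
half n = fromℕ n ℚ.* ½

half-mono : ∀ {m n} → m ℕ.≤ n → half m ℚ.≤ half n
half-mono m≤n = ℚ.*-monoʳ-≤-nonNeg ½ (fromℕ-mono m≤n)

half-2* : ∀ n → half (2 ℕ.* n) ≡ fromℕ n
half-2* n = trans (cong (ℚ._* ½) (fromℕ-* 2 n))
  (solve 1 (λ x → con (fromℕ 2) :* x :* con ½ := x) refl (fromℕ n))
  where open ℚ-Solver

∑-half : ∀ {A : Set} (us : List A) f → ∑ us (half ∘ f) ≡ half (sumᴸ (map f us))
∑-half []       f = refl
∑-half (u ∷ us) f = begin
  half (f u) ℚ.+ ∑ us (half ∘ f)                        ≡⟨ cong (half (f u) ℚ.+_) (∑-half us f) ⟩
  half (f u) ℚ.+ half (sumᴸ (map f us))                 ≡⟨ ℚ.*-distribʳ-+ ½ (fromℕ (f u)) _ ⟨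
  (fromℕ (f u) ℚ.+ fromℕ (sumᴸ (map f us))) ℚ.* ½       ≡⟨ cong (ℚ._* ½) (fromℕ-+ (f u) _) ⟨
  half (f u ℕ.+ sumᴸ (map f us))                        ∎
  where open ≡-Reasoning

-- From doubled weights in ℕ to a solution over ℚ

half-feasible : ∀ t h → h (source t) ≡ 0 → HartkeBounded 0 t h → LP′-Feasible t (half ∘ h) (half ∘ pathTotal h)
half-feasible t h h≡0 hb = record
  { hartke   = λ v j v<j → ℚ.≤-trans (ℚ.≤-reflexive (∑-hartke v j)) (half-mono {hartkeTotal t h v j} {2} (HartkeBounded.hartke≤2 hb v j v<j))
  ; y≤∑x     = λ v → ℚ.≤-reflexive (sym (∑-half (path v) h))
  ; 0≤x      = λ v → half-mono {0} {h v} z≤n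
  ; x≤1      = λ v → half-mono {h v} {2} (ℕ.≤-trans (≤pathTotal h v) (pathTotal≤2 v))
  ; 0≤y      = λ v → half-mono {0} {pathTotal h v} z≤n
  ; y≤1      = λ v → half-mono {pathTotal h v} {2} (pathTotal≤2 v)
  ; x-source = cong half h≡0
  }
  where
    pathTotal≤2 : ∀ v → pathTotal h v ℕ.≤ 2
    pathTotal≤2 v =
      ℕ.≤-trans (pathTotal≤hartkeTotal h v (suc (depth v)) ℕ.≤-refl) (HartkeBounded.hartke≤2 hb v _ ℕ.≤-refl)

    ∑-hartke : ∀ v j → ∑ (filter (hartkeSet? v j) (vertices t)) (half ∘ h) ≡ half (hartkeTotal t h v j)
    ∑-hartke v j = trans (∑-half (filter (hartkeSet? v j) (vertices t)) h)
      (cong half (trans (sumᴸ-filter (hartkeSet? v j) h (vertices t)) (sumᴸ-vertices t _)))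

half-objective≤ : ∀ {t h lp} → IsLP′ t lp → LP′-Feasible t (half ∘ h) (half ∘ pathTotal h) →
  half (objective 0 t h) ℚ.≤ lp
half-objective≤ {t} {h} (_ , ≤lp) feasible = subst (ℚ._≤ _)
  (trans (∑-half (vertices t) (pathTotal h)) (cong half (sumᴸ-vertices t (pathTotal h)))) (≤lp (half ∘ h , half ∘ pathTotal h) feasible)

-- The numerator of a positive rational is at least 1.
1≤denominator*ε : ∀ ε → 0ℚ ℚ.< ε → 1ℚ ℚ.≤ fromℕ (ℚ.↧ₙ ε) ℚ.* ε
1≤denominator*ε ε@(mkℚ (+ zero)  d-1 _) 0<ε = contradiction (ℚ.positive 0<ε) λ ()
1≤denominator*ε ε@(mkℚ -[1+ n ] d-1 _) 0<ε = contradiction (ℚ.positive 0<ε) λ ()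
1≤denominator*ε ε@(mkℚ +[1+ n ] d-1 _) _   = ℚ.toℚᵘ-cancel-≤ (begin
  toℚᵘ 1ℚ                                    ≤⟨ *≤* (ℤ.+≤+ 1≤) ⟩
  mkℚᵘ (+ suc d-1) 0 ℚᵘ.* toℚᵘ ε            ≃⟨ ℚᵘ.*-cong (toℚᵘ-fromℕ (suc d-1)) (ℚᵘ.≃-refl {toℚᵘ ε}) ⟨
  toℚᵘ (fromℕ (suc d-1)) ℚᵘ.* toℚᵘ ε        ≃⟨ ℚ.toℚᵘ-homo-* (fromℕ (suc d-1)) ε ⟨
  toℚᵘ (fromℕ (suc d-1) ℚ.* ε)              ∎)
  where
    open ℚᵘ.≤-Reasoning
    1≤ : 1 ℕ.* (1 ℕ.* suc d-1) ℕ.≤ suc d-1 ℕ.* suc n ℕ.* 1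
    1≤ = ℕ.≤-trans (ℕ.≤-reflexive (trans (ℕ.*-identityˡ _) (ℕ.*-identityˡ _)))
      (ℕ.≤-trans (ℕ.m≤m*n (suc d-1) (suc n)) (ℕ.≤-reflexive (sym (ℕ.*-identityʳ _))))

÷≤ : ∀ {p q r} (q>0 : Positive q) → p ℚ.≤ r ℚ.* q → (p ÷ q) {{ℚ.pos⇒nonZero q {{q>0}}}} ℚ.≤ r
÷≤ {p} {q} {r} q>0 p≤rq = ℚ.*-cancelʳ-≤-pos q (begin
  (p ÷ q) ℚ.* q              ≡⟨ ℚ.*-assoc p (ℚ.1/ q) q ⟩
  p ℚ.* (ℚ.1/ q ℚ.* q)       ≡⟨ cong (p ℚ.*_) (ℚ.*-inverseˡ q) ⟩
  p ℚ.* 1ℚ                   ≡⟨ ℚ.*-identityʳ p ⟩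
  p                          ≤⟨ p≤rq ⟩
  r ℚ.* q                    ∎)
  where
    open ℚ.≤-Reasoning
    instance
      _ = q>0
      _ = ℚ.pos⇒nonZero q

-- Choice of the parameters: `W = p * b = q * K = R⁵`

module Scaled (r : ℕ) where
  R R² R³ R⁴ R⁵ : ℕ
  R  = suc r
  R² = R ℕ.* R
  R³ = R ℕ.* R²
  R⁴ = R ℕ.* R³
  R⁵ = R ℕ.* R⁴

  open Instance r R² R⁵ R⁴ R³ public

  6R⁵≤objective : 2 ℕ.* (6 ℕ.* R⁵) ℕ.≤ objective 0 tree h
  6R⁵≤objective = ℕ.≤-trans (ℕ.≤-reflexive
    (solve 1 (λ x → let x² = x :* x ; x³ = x :* x² ; x⁴ = x :* x³ ; x⁵ = x :* x⁴ in
      con 2 :* (con 6 :* x⁵) := con 2 :* (x⁵ :+ (x :+ x) :* x⁴ :+ x :* x⁴ :+ (x² :* x³ :+ x² :* x³))) refl R))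
    objective-tree
    where open ℕ-Solver

  -- The cases differ in `lost`, the contested weight, and `extra`, what the picks may cover of it.
  -- `slack` turns the remaining polynomial inequality into an identity for the ring solver. It is
  -- given in `r = R - 1`, where its coefficients are natural numbers; in powers of `R` some would
  -- be negative.
  cancel : ∀ {c} extra slack lost bound → c ℕ.+ lost ℕ.≤ size tree ℕ.+ extra →
    6 ℕ.+ R⁵ ℕ.+ (R ℕ.+ R ℕ.+ R) ℕ.* (N ℕ.+ R⁴) ℕ.+ (R² ℕ.+ R²) ℕ.* (N ℕ.+ R³) ℕ.+ extra ℕ.+ slack ≡ bound ℕ.+ lost →
    c ℕ.≤ bound
  cancel {c} extra slack lost bound c≤ eq = ℕ.+-cancelʳ-≤ lost c bound (begin
    c ℕ.+ lost                ≤⟨ c≤ ⟩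
    size tree ℕ.+ extra       ≤⟨ ℕ.+-monoˡ-≤ extra size-tree≤ ⟩
    _                         ≤⟨ ℕ.m≤m+n _ slack ⟩
    _                         ≡⟨ eq ⟩
    bound ℕ.+ lost            ∎)
    where open ℕ.≤-Reasoning

  -- Each slack polynomial in r has been read off from the two sides.
  savedCount≤ : ∀ σ → savedCount {tree} σ ℕ.≤ 5 ℕ.* R⁵ ℕ.+ 78 ℕ.* R⁴
  savedCount≤ σ with σ 0 ≟ᵛ rootB | σ 1 ≟ᵛ topC
  ... | no σ0≢  | _       =
    cancel _ (9 ℕ.+ r ℕ.* (206 ℕ.+ r ℕ.* (392 ℕ.+ r ℕ.* (283 ℕ.+ r ℕ.* 73)))) _ _ (BD.savedCount≤ σ σ0≢)
    (solve 1 (λ r → let x = con 1 :+ r ; x² = x :* x ; x³ = x :* x² ; x⁴ = x :* x³ ; x⁵ = x :* x⁴ ; n = con 3 :+ (x :+ x) :+ x² in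
      (con 6 :+ x⁵ :+ (x :+ x :+ x) :* (n :+ x⁴) :+ (x² :+ x²) :* (n :+ x³)) :+ (con 3 :+ (x :+ x)) :* (n :+ x⁴)
        :+ (con 9 :+ r :* (con 206 :+ r :* (con 392 :+ r :* (con 283 :+ r :* con 73))))
      := (con 5 :* x⁵ :+ con 78 :* x⁴) :+ (x :+ x :+ x) :* x⁴) refl r)
    where open ℕ-Solver
  ... | yes σ0≡ | no σ1≢  =
    cancel _ (1 ℕ.+ r ℕ.* (185 ℕ.+ r ℕ.* (374 ℕ.+ r ℕ.* (278 ℕ.+ r ℕ.* 73)))) _ _ (AC.savedCount≤ σ σ0≡ σ1≢)
    (solve 1 (λ r → let x = con 1 :+ r ; x² = x :* x ; x³ = x :* x² ; x⁴ = x :* x³ ; x⁵ = x :* x⁴ ; n = con 3 :+ (x :+ x) :+ x² in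
      (con 6 :+ x⁵ :+ (x :+ x :+ x) :* (n :+ x⁴) :+ (x² :+ x²) :* (n :+ x³)) :+ n :* (n :+ x³)
        :+ (con 1 :+ r :* (con 185 :+ r :* (con 374 :+ r :* (con 278 :+ r :* con 73))))
      := (con 5 :* x⁵ :+ con 78 :* x⁴) :+ (x² :+ x²) :* x³) refl r)
    where open ℕ-Solver
  ... | yes σ0≡ | yes σ1≡ =
    cancel _ (39 ℕ.+ r ℕ.* (250 ℕ.+ r ℕ.* (423 ℕ.+ r ℕ.* (297 ℕ.+ r ℕ.* 76)))) _ _ (A₁.savedCount≤ σ σ0≡ σ1≡)
    (solve 1 (λ r → let x = con 1 :+ r ; x² = x :* x ; x³ = x :* x² ; x⁴ = x :* x³ ; x⁵ = x :* x⁴ ; n = con 3 :+ (x :+ x) :+ x² in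
      (con 6 :+ x⁵ :+ (x :+ x :+ x) :* (n :+ x⁴) :+ (x² :+ x²) :* (n :+ x³)) :+ con 3
        :+ (con 39 :+ r :* (con 250 :+ r :* (con 423 :+ r :* (con 297 :+ r :* con 76))))
      := (con 5 :* x⁵ :+ con 78 :* x⁴) :+ x⁵) refl r)
    where open ℕ-Solver


  feasible : LP′-Feasible tree (half ∘ h) (half ∘ pathTotal h)
  feasible = half-feasible tree h refl hartke-tree

  6R⁵≤lp : ∀ {lp} → IsLP′ tree lp → fromℕ (6 ℕ.* R⁵) ℚ.≤ lp
  6R⁵≤lp {lp} isLP′ = begin
    fromℕ (6 ℕ.* R⁵)             ≡⟨ half-2* (6 ℕ.* R⁵) ⟨
    half (2 ℕ.* (6 ℕ.* R⁵))      ≤⟨ half-mono {2 ℕ.* (6 ℕ.* R⁵)} {objective 0 tree h} 6R⁵≤objective ⟩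
    half (objective 0 tree h)    ≤⟨ half-objective≤ {tree} {h} isLP′ feasible ⟩
    lp                           ∎
    where open ℚ.≤-Reasoning

  lp>0 : ∀ {lp} → IsLP′ tree lp → Positive lp
  lp>0 {lp} isLP′ = ℚ.positive (ℚ.<-≤-trans {0ℚ} {1ℚ} {lp} (ℚ.positive⁻¹ 1ℚ)
    (ℚ.≤-trans {1ℚ} {fromℕ (6 ℕ.* R⁵)} {lp} (fromℕ-mono {1} {6 ℕ.* R⁵} (s≤s z≤n)) (6R⁵≤lp isLP′)))

  opt≤ : ∀ {opt} → IsOPT tree opt → fromℕ opt ℚ.≤ fromℕ 5 ℚ.* fromℕ R⁵ ℚ.+ fromℕ 78 ℚ.* fromℕ R⁴
  opt≤ ((σ , _ , refl) , _) = begin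
    fromℕ (savedCount {tree} σ)                    ≤⟨ fromℕ-mono (savedCount≤ σ) ⟩
    fromℕ (5 ℕ.* R⁵ ℕ.+ 78 ℕ.* R⁴)                 ≡⟨ fromℕ-+ (5 ℕ.* R⁵) (78 ℕ.* R⁴) ⟩
    fromℕ (5 ℕ.* R⁵) ℚ.+ fromℕ (78 ℕ.* R⁴)         ≡⟨ cong₂ ℚ._+_ (fromℕ-* 5 R⁵) (fromℕ-* 78 R⁴) ⟩
    fromℕ 5 ℚ.* fromℕ R⁵ ℚ.+ fromℕ 78 ℚ.* fromℕ R⁴ ∎
    where open ℚ.≤-Reasoning

  -- Since `78 = 6 * 13` and `R = 13 * d`, the error is `78 R⁴ ≤ 78 R⁴ * (d * ε) = 6 R⁵ * ε`, and
  -- `5 R⁵ + 6 R⁵ * ε = (5/6 + ε) * 6 R⁵`. At `R = 1` the estimate with `rootB` but without `topC`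
  -- already needs 77 in place of 78.
  ratio≤ : ∀ {ε d opt lp} → ℚ.NonNegative ε → 1ℚ ℚ.≤ d ℚ.* ε → fromℕ R ≡ fromℕ 13 ℚ.* d → IsOPT tree opt →
    IsLP′ tree lp →
           fromℕ opt ℚ.≤ ((+ 5 ℚ./ 6) ℚ.+ ε) ℚ.* lp
  ratio≤ {ε} {d} {opt} {lp} ε≥0 1≤dε R≡ isOPT isLP′ = begin
    fromℕ opt
      ≤⟨ opt≤ isOPT ⟩
    fromℕ 5 ℚ.* w ℚ.+ fromℕ 78 ℚ.* u
      ≡⟨ cong (fromℕ 5 ℚ.* w ℚ.+_) (ℚ.*-identityʳ (fromℕ 78 ℚ.* u)) ⟨
    fromℕ 5 ℚ.* w ℚ.+ fromℕ 78 ℚ.* u ℚ.* 1ℚ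
      ≤⟨ ℚ.+-monoʳ-≤ (fromℕ 5 ℚ.* w) (ℚ.*-monoˡ-≤-nonNeg (fromℕ 78 ℚ.* u)
           {{ℚ.nonNeg*nonNeg⇒nonNeg (fromℕ 78) u {{fromℕ-nonNegative R⁴}}}} 1≤dε) ⟩
    fromℕ 5 ℚ.* w ℚ.+ fromℕ 78 ℚ.* u ℚ.* (d ℚ.* ε)
      ≡⟨ cong (λ w → fromℕ 5 ℚ.* w ℚ.+ fromℕ 78 ℚ.* u ℚ.* (d ℚ.* ε)) w≡ ⟩
    fromℕ 5 ℚ.* (fromℕ 13 ℚ.* d ℚ.* u) ℚ.+ fromℕ 78 ℚ.* u ℚ.* (d ℚ.* ε)
      ≡⟨ solve 3 (λ d u ε → con (fromℕ 5) :* (con (fromℕ 13) :* d :* u) :+ con (fromℕ 78) :* u :* (d :* ε)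
           := (con (+ 5 ℚ./ 6) :+ ε) :* (con (fromℕ 6) :* (con (fromℕ 13) :* d :* u))) refl d u ε ⟩
    c ℚ.* (fromℕ 6 ℚ.* (fromℕ 13 ℚ.* d ℚ.* u))
      ≡⟨ cong (λ w → c ℚ.* (fromℕ 6 ℚ.* w)) w≡ ⟨
    c ℚ.* (fromℕ 6 ℚ.* w)
      ≡⟨ cong (c ℚ.*_) (fromℕ-* 6 R⁵) ⟨
    c ℚ.* fromℕ (6 ℕ.* R⁵)
      ≤⟨ ℚ.*-monoˡ-≤-nonNeg c {{ℚ.nonNeg+nonNeg⇒nonNeg (+ 5 ℚ./ 6) ε {{ε≥0}}}} (6R⁵≤lp isLP′) ⟩
    c ℚ.* lp ∎
    where
      open ℚ.≤-Reasoning
      open ℚ-Solver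
      c w u : ℚ
      c = (+ 5 ℚ./ 6) ℚ.+ ε
      w = fromℕ R⁵
      u = fromℕ R⁴
      w≡ : w ≡ fromℕ 13 ℚ.* d ℚ.* u
      w≡ = trans (fromℕ-* R R⁴) (cong (ℚ._* u) R≡)

  gap : ∀ {ε d} → ℚ.NonNegative ε → 1ℚ ℚ.≤ d ℚ.* ε → fromℕ R ≡ fromℕ 13 ℚ.* d →
    ∃[ t ] ∃[ opt ] ∃[ lp ] IsOPT t opt × IsLP′ t lp ×
    (Σ[ lp>0 ∈ Positive lp ]
    (fromℕ opt ÷ lp) {{ℚ.pos⇒nonZero lp {{lp>0}}}} ℚ.≤ (+ 5 ℚ./ 6) ℚ.+ ε)
  gap {ε} {d} ε≥0 1≤dε R≡ = tree , conclude (OPT-exists tree) (LP′-exists tree feasible)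
    where
      conclude : ∃[ opt ] IsOPT tree opt → ∃[ lp ] IsLP′ tree lp →
        ∃[ opt ] ∃[ lp ] IsOPT tree opt × IsLP′ tree lp ×
        (Σ[ lp>0 ∈ Positive lp ] (fromℕ opt ÷ lp) {{ℚ.pos⇒nonZero lp {{lp>0}}}} ℚ.≤ (+ 5 ℚ./ 6) ℚ.+ ε)
      conclude (opt , isOPT) (lp , isLP′) = opt , lp , isOPT , isLP′ , lp>0 isLP′ ,
        ÷≤ {fromℕ opt} {lp} (lp>0 isLP′) (ratio≤ {ε} {d} ε≥0 1≤dε R≡ isOPT isLP′)

13*suc : ∀ n → fromℕ (suc (12 ℕ.+ 13 ℕ.* n)) ≡ fromℕ 13 ℚ.* fromℕ (suc n)
13*suc n = trans (cong fromℕ (sym (ℕ.*-suc 13 n))) (fromℕ-* 13 (suc n))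

open import Data.Rational using (_/_; _+_; _÷_; _≤_; _<_)
open import Data.Rational.Properties using (pos⇒nonZero)

mainTheorem8 : (ε : ℚ) → 0ℚ < ε →
    ∃[ t ] ∃[ opt ] ∃[ lp ] IsOPT t opt × IsLP′ t lp ×
    (Σ[ lp>0 ∈ Positive lp ]
    (fromℕ opt ÷ lp) {{pos⇒nonZero lp {{lp>0}}}} ≤ (+ 5 / 6) + ε)
-- `Scaled` expects `R - 1`, so this choice makes `R` 13 times the denominator of `ε`.
mainTheorem8 ε 0<ε = Scaled.gap (12 ℕ.+ 13 ℕ.* ℚ.denominator-1 ε) {ε} {fromℕ (ℚ.↧ₙ ε)}
  (ℚ.pos⇒nonNeg ε {{ℚ.positive 0<ε}}) (1≤denominator*ε ε 0<ε) (13*suc (ℚ.denominator-1 ε))
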